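{- Let $T$ be a binary tree on $n\geq 12$ vertices and let $h$ be the smallest positive integer such that $\lceil\frac{n}{4}\rceil\leq 2^h-1$. Then $$d_T(C(T),C_d(T))\leq \left\lfloor \frac{n}{4}\right\rfloor - \left\lfloor\frac{\lfloor \frac{n}{4}\rfloor+1+h}{2}\right\rfloor,$$ and equality holds if $T\cong T_{rg}^{n,l}$ where $l=2\lceil\frac{n}{4}\rceil+1$.
   Context: All graphs are finite, simple, connected and undirected. A pendant vertex is a vertex of degree $1$. A binary tree is a tree in which every non-pendant vertex has degree $3$ (so its number of vertices is even). Center and centroid: the eccentricity of $v\in V(T)$ is $e(v)=\max_{u}d_T(u,v)$; the center $C(T)$ is the set of vertices of minimum eccentricity. A branch at $v$ is a maximal subtree of $T$ containing $v$ as a pendant vertex; the weight of $v$ is the maximum number of edges in a branch at $v$; the centroid $C_d(T)$ is the set of vertices of minimum weight. For $X,Y\subseteq V(T)$, $d_T(X,Y)=\min\{d_T(x,y):x\in X,y\in Y\}$. Rooted binary trees: a rooted binary tree is a rooted tree whose root has degree $2$ and in which every other vertex has degree $1$ or $3$; the single-vertex rooted tree is also allowed. The height (level) of a vertex is its distance to the root. A rooted binary tree is ordered if the vertices of each level $l\ge 1$ are linearly ordered so that two vertices at level $l+1$ with different parents are ordered as their parents are at level $l$. A rooted binary tree is rgood if (i) the heights of any two of its pendant vertices differ by at most $1$, and (ii) it can be ordered so that the parents of the pendant vertices at the highest level form a final segment in the ordering of the vertices at the next-to-highest level. For each odd $l$ there is, up to isomorphism, exactly one rgood binary tree on $l$ vertices,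 denoted $T_{rg}^l$. Crg trees: a binary caterpillar is a binary tree having a path such that every vertex not on the path is adjacent to a vertex of the path. For even $n\ge 4$ and odd $l$ with $3\le l<n$, the crg tree $T_{rg}^{n,l}$ is the tree on $n$ vertices obtained by identifying the root of $T_{rg}^l$ with a vertex of maximum eccentricity of a binary caterpillar on $n-l+1$ vertices. -}

module Defs where

open import Data.Fin.Base using (Fin)
open import Data.Fin.Properties using (_<?_)
open import Data.Fin.Subset using (Subset; _∈_; _∉_; _⊆_; ∣_∣; ⊤)
open import Data.Fin.Subset.Properties using (_∈?_)
open import Data.List.Base using (List; _∷_; []; _∷ʳ_; length; filter; allFin; cartesianProduct)
import Data.List.Membership.Propositional as List
open import Data.List.Relation.Unary.Linked using (Linked)
open import Data.List.Relation.Unary.Unique.Propositional using (Unique)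
open import Data.Nat.Base using (ℕ; zero; suc; _+_; _∸_; _≤_; _<_; _/_; ∣_-_∣)
open import Data.Product.Base using (Σ; ∃; ∃-syntax; _×_; _,_; proj₁)
open import Data.Sum.Base using (_⊎_)
open import Function.Definitions using (Injective)
open import Level using (0ℓ)
open import Relation.Binary.Core using (Rel)
open import Relation.Binary.Structures using (IsStrictTotalOrder)
open import Relation.Binary.PropositionalEquality.Core using (_≡_; _≢_)
open import Relation.Nullary.Decidable.Core using (_×-dec_)
open import Relation.Nullary.Negation.Core using (¬_)

⌈_/4⌉ : ℕ → ℕ
⌈ n /4⌉ = (n + 3) / 4

IsMin IsMax : (ℕ → Set) → ℕ → Set
IsMin P m = P m × (∀ k → P k → m ≤ k)
IsMax P m = P m × (∀ k → P k → k ≤ m)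

-- For a functional relation R, read as a ℕ-valued map on A:
-- the elements of A at which the value is smallest, respectively largest.
Minimizer Maximizer : {A : Set} → (A → ℕ → Set) → A → Set
Minimizer R x = ∃[ k ] R x k × (∀ y j → R y j → k ≤ j)
Maximizer R x = ∃[ k ] R x k × (∀ y j → R y j → j ≤ k)

------------------------------------------------------------------------
-- Graphs

-- Finite simple undirected graphs on the vertices Fin n, given by their
-- neighbourhoods.  Connectedness is part of IsTree.
record Graph (n : ℕ) : Set where
  field
    nbrs   : Fin n → Subset n
    sym    : ∀ {u v} → v ∈ nbrs u → u ∈ nbrs v
    irrefl : ∀ {v} → v ∉ nbrs v

  Adj : Rel (Fin n) 0ℓ
  Adj u v = v ∈ nbrs u

  degree : Fin n → ℕ
  degree v = ∣ nbrs v ∣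

  IsPendant : Fin n → Set
  IsPendant v = degree v ≡ 1

  numEdges : ℕ
  numEdges = length (filter (λ (u , v) → u <? v ×-dec v ∈? nbrs u)
                            (cartesianProduct (allFin n) (allFin n)))

open Graph public

module _ {n : ℕ} (G : Graph n) where

  data Walk : Fin n → Fin n → ℕ → Set where
    []  : ∀ {v} → Walk v v zero
    _∷_ : ∀ {u v w k} → Adj G u v → Walk v w k → Walk u w (suc k)

  IsDist : Fin n → Fin n → ℕ → Set
  IsDist u v = IsMin (Walk u v)

  IsPath : List (Fin n) → Set
  IsPath p = Unique p × Linked (Adj G) p

  -- The cycle runs through x, then xs, and back to x.
  IsCycle : Fin n → List (Fin n) → Set
  IsCycle x xs = 2 ≤ length xs × Unique (x ∷ xs) × Linked (Adj G) (x ∷ xs ∷ʳ x)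

  Acyclic : Set
  Acyclic = ∀ x xs → ¬ IsCycle x xs

  ConnectedOn : Subset n → Set
  ConnectedOn S = ∀ {u v} → u ∈ S → v ∈ S → ∃[ k ] Walk u v k

  IsTree : Set
  IsTree = ConnectedOn ⊤ × Acyclic

  IsBinaryTree : Set
  IsBinaryTree = IsTree × (∀ v → ¬ IsPendant G v → degree G v ≡ 3)

  IsSetDist : (X Y : Fin n → Set) → ℕ → Set
  IsSetDist X Y = IsMin λ k → ∃[ x ] ∃[ y ] X x × Y y × IsDist x y k

------------------------------------------------------------------------
-- Center

  IsEccentricity : Fin n → ℕ → Set
  IsEccentricity v = IsMax λ k → ∃[ u ] IsDist u v k

  Center : Fin n → Set
  Center = Minimizer IsEccentricity

------------------------------------------------------------------------
-- Centroid

  -- The edges of a subgraph are kept as a graph on all of Fin n, in which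
  -- the vertices outside verts are isolated.
  record Subgraph : Set where
    field
      verts   : Subset n
      edges   : Graph n
      edges⊆  : ∀ {u v} → Adj edges u v → Adj G u v
      edges-∈ : ∀ {u v} → Adj edges u v → u ∈ verts

module _ {n : ℕ} {G : Graph n} where

  open Subgraph

  _⊑_ : Rel (Subgraph G) 0ℓ
  H ⊑ K = verts H ⊆ verts K × (∀ {u v} → Adj (edges H) u v → Adj (edges K) u v)

  IsSubtree : Subgraph G → Set
  IsSubtree H = ConnectedOn (edges H) (verts H) × Acyclic (edges H)

  IsSubtreePendantAt : Fin n → Subgraph G → Set
  IsSubtreePendantAt v H = IsSubtree H × v ∈ verts H × IsPendant (edges H) v

  IsBranch : Fin n → Subgraph G → Set
  IsBranch v B = IsSubtreePendantAt v B × (∀ H → IsSubtreePendantAt v H → B ⊑ H → H ⊑ B)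

module _ {n : ℕ} (G : Graph n) where

  IsWeight : Fin n → ℕ → Set
  IsWeight v = IsMax λ k → Σ (Subgraph G) λ B → IsBranch v B × numEdges (Subgraph.edges B) ≡ k

  Centroid : Fin n → Set
  Centroid = Minimizer IsWeight

------------------------------------------------------------------------
-- Rooted binary trees

module _ {n : ℕ} (G : Graph n) (r : Fin n) where

  IsRootedBinaryTree : Set
  IsRootedBinaryTree = IsTree G ×
    (n ≡ 1 ⊎ (degree G r ≡ 2 × (∀ v → v ≢ r → degree G v ≡ 1 ⊎ degree G v ≡ 3)))

  IsHeight : Fin n → ℕ → Set
  IsHeight v = IsDist G r v

  Level : ℕ → Set
  Level l = ∃[ v ] IsHeight v l

  IsMaxHeight : ℕ → Set
  IsMaxHeight = IsMax λ l → Level l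

  IsParent : Fin n → Fin n → Set
  IsParent u v = Adj G u v × (∃[ l ] IsHeight u l × IsHeight v (suc l))

  -- Only the comparison of two vertices on the same level l ≥ 1 is meaningful.
  record IsOrdering (_≺_ : Rel (Fin n) 0ℓ) : Set where
    field
      linear  : ∀ l → 1 ≤ l →
                IsStrictTotalOrder {A = Level l} (λ x y → proj₁ x ≡ proj₁ y)
                                                 (λ x y → proj₁ x ≺ proj₁ y)
      parents : ∀ l → 1 ≤ l → ∀ {u u′ v v′} →
                IsHeight v (suc l) → IsHeight v′ (suc l) →
                IsParent u v → IsParent u′ v′ → u ≢ u′ →
                u ≺ u′ → v ≺ v′

  IsParentOfPendantAt : ℕ → Fin n → Set
  IsParentOfPendantAt l u = ∃[ v ] IsParent u v × IsHeight v l × IsPendant G v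

  record IsRgood : Set₁ where
    field
      rootedBinaryTree : IsRootedBinaryTree
      balanced         : ∀ {u v a b} → IsPendant G u → IsPendant G v →
                         IsHeight u a → IsHeight v b → ∣ a - b ∣ ≤ 1
      _≺_              : Rel (Fin n) 0ℓ
      ordering         : IsOrdering _≺_
      -- For l = 0 the level below the top one is just the root, so the
      -- unconstrained values of ≺ there do no harm.
      finalSegment     : ∀ {l} → IsMaxHeight (suc l) →
                         ∀ {u u′} → IsHeight u l → IsHeight u′ l → u ≺ u′ →
                         IsParentOfPendantAt (suc l) u → IsParentOfPendantAt (suc l) u′

------------------------------------------------------------------------
-- Crg trees

IsBinaryCaterpillar : ∀ {n} → Graph n → Set
IsBinaryCaterpillar G = IsBinaryTree G ×
  (∃[ p ] IsPath G p × (∀ v → v List.∉ p → ∃[ u ] u List.∈ p × Adj G v u))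

-- G is, up to isomorphism, the graph obtained from the disjoint union of
-- H and K by identifying the vertex a of H with the vertex b of K: the maps f
-- and g are the two inclusions.
record IsIdentification {n m k : ℕ} (G : Graph n)
                        (H : Graph m) (a : Fin m) (K : Graph k) (b : Fin k) : Set where
  field
    f       : Fin m → Fin n
    g       : Fin k → Fin n
    f-inj   : Injective _≡_ _≡_ f
    g-inj   : Injective _≡_ _≡_ g
    cover   : ∀ v → (∃[ x ] f x ≡ v) ⊎ (∃[ y ] g y ≡ v)
    glue    : f a ≡ g b
    meet    : ∀ {x y} → f x ≡ g y → x ≡ a × y ≡ b
    f-adj   : ∀ {x x′} → Adj H x x′ → Adj G (f x) (f x′)
    g-adj   : ∀ {y y′} → Adj K y y′ → Adj G (g y) (g y′)
    adj     : ∀ {u v} → Adj G u v →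
              (∃[ x ] ∃[ x′ ] f x ≡ u × f x′ ≡ v × Adj H x x′) ⊎
              (∃[ y ] ∃[ y′ ] g y ≡ u × g y′ ≡ v × Adj K y y′)

-- G is isomorphic to the crg tree T_rg^{n,l}.  The trees on l and on n - l + 1
-- vertices are unique up to isomorphism, and so need not be fixed here.
record IsCrg {n : ℕ} (l : ℕ) (G : Graph n) : Set₁ where
  field
    3≤l             : 3 ≤ l
    l<n             : l < n
    R               : Graph l
    root            : Fin l
    rgood           : IsRgood R root
    K               : Graph (n ∸ l + 1)
    tip             : Fin (n ∸ l + 1)
    caterpillar     : IsBinaryCaterpillar K
    tip-maxEcc      : Maximizer (IsEccentricity K) tip
    identification  : IsIdentification G R root K tip

{-# OPTIONS --safe #-}

-- Write q = ⌊n/4⌋; the bound is ⌊(q-h)/2⌋.  In a tree, each neighbour u of v determines the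
-- set of vertices on the u-side of the edge vu; these sets are the branches at v, and their
-- sizes (odd in a binary tree) are the numbers of edges of the branches.
--
-- Upper bound.  Let z (center) and c (centroid) be at minimal distance D > 0, and let c′ be
-- the neighbour of c toward z.  As c′ is not in the centroid, the c-side of cc′ has more than
-- n/2 vertices, hence a vertex at depth at least h below c.  As the neighbour of z toward c
-- is not in the center, the c′-side reaches at least 2D + h away from c.  But it has fewer
-- than n/2 vertices, and depth k below c′ needs 2k+1 vertices, so 2D + h ≤ q.
--
-- Equality.  In a crg tree the rgood part has more than n/2 vertices, so it contains the
-- whole centroid, and its height is at most h.  The caterpillar part has diameter Q ≥ q,
-- which is attained at the glued vertex r.  With φ = ⌊(q-h)/2⌋, the vertex z at distance φ
-- from r on such a diameter has eccentricity at most Q - φ, whereas the far end of the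
-- diameter is at distance at least Q from every vertex of the centroid.

module Submission where

open import Defs hiding (sym)
open Graph using () renaming (sym to adj-sym)
open import Data.Empty using (⊥; ⊥-elim)
open import Data.Bool.Base using (true; false)
open import Data.Fin.Base as Fin using (Fin; zero; suc)
import Data.Fin.Properties as Fin
open import Data.Fin.Subset using (Subset; _∈_; ∣_∣; ⊤)
open import Data.Fin.Subset.Properties using (_∈?_; ∈⊤)
import Data.Integer.Base as ℤ
import Data.Integer.Properties as ℤₚ
open import Data.List.Base using (List; []; _∷_; _++_; _∷ʳ_; map; length; filter; concat; allFin; cartesianProduct)
import Data.List.Properties as List
open import Data.List.Membership.Propositional using () renaming (_∈_ to _∈ˡ_)
open import Data.List.Membership.Propositional.Properties
  using (∈-∃++; ∈-++⁺ˡ; ∈-++⁺ʳ; ∈-++⁻; ∈-map⁺; ∈-map⁻; ∈-filter⁺; ∈-filter⁻; ∈-allFin; ∈-concat⁺′; ∈-concat⁻′; ∈-cartesianProduct⁺)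
open import Data.List.Relation.Unary.All as All using (All; []; _∷_)
import Data.List.Relation.Unary.All.Properties as All
open import Data.List.Relation.Unary.AllPairs as AllPairs using (AllPairs; []; _∷_)
import Data.List.Relation.Unary.AllPairs.Properties as AllPairs
open import Data.List.Relation.Unary.Any using (here; there; any?)
open import Data.List.Relation.Unary.Linked as Linked using (Linked; []; [-]; _∷_)
open import Data.List.Relation.Unary.Unique.Propositional using (Unique)
import Data.List.Relation.Unary.Unique.Propositional.Properties as Unique
open import Data.Nat.Base using (ℕ; zero; suc; pred; _+_; _*_; _∸_; _^_; _≤_; _<_; _/_; z≤n; s≤s; NonZero; >-nonZero)
import Data.Nat.DivMod as ℕ
open import Data.Nat.ListAction using (sum)
import Data.Nat.Properties as ℕ
open import Data.Product.Base using (Σ; ∃; ∃-syntax; _×_; _,_; proj₁; proj₂)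
open import Data.Sum.Base using (_⊎_; inj₁; inj₂; [_,_]′; swap)
import Data.Vec.Base as Vec
import Data.Vec.Properties as Vec
open import Function.Base using (_∘_; id; flip)
open import Relation.Binary.Definitions using (tri<; tri≈; tri>)
open import Relation.Binary.Construct.Closure.ReflexiveTransitive as Star using (Star; ε; _◅_; _◅◅_)
open import Relation.Binary.PropositionalEquality using (_≡_; _≢_; refl; sym; trans; cong; cong₂; subst; subst₂; module ≡-Reasoning)
open import Relation.Nullary using (¬_; Dec; yes; no; does; contradiction)
open import Relation.Nullary.Decidable using (_×-dec_; _⊎-dec_; map′)
open import Relation.Unary using (Decidable)
open import Data.Nat.Solver using (module +-*-Solver)

-- Trees are handled through distances alone: `Side` compares two distances, and acyclicity enters
-- these arguments only in `no-avoiding`. Weights, which quantify over subgraphs, are reduced to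
-- sizes of sides, where a finite search is possible.
--
-- Origin of `h`: the two sides of `cc′` have odd sizes `2b+1 < 2a+1`, so `n = 2(a+b+1)` yields
-- `b+1 ≤ q` and `⌈n/4⌉ ≤ a`. Minimality of `h` gives `2^(h-1) ≤ ⌈n/4⌉`, hence `2^h ≤ 2a+1`, which
-- forces a vertex at depth `h` on the heavier side. The lighter side has depth at most `b`, and the
-- edge `cc′` makes this `b+1`.
--
-- Origin of `l`: `2⌈n/4⌉+1` is the least odd number above `n/2`. It makes the rgood part just heavy
-- enough to hold the centroid and leaves as many vertices as possible, at least `2q`, to the
-- caterpillar, whose diameter is at least half its order. The center of a crg tree is never
-- located: it suffices to compare the eccentricity of `z` with that of an arbitrary central vertex.

pigeonhole : ∀ {A B : Set} {xs : List A} {ys : List B} (R : A → B → Set) → Unique xs →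
             (∀ {x} → x ∈ˡ xs → ∃[ y ] y ∈ˡ ys × R x y) →
             (∀ {x x′ y} → R x y → R x′ y → x ≡ x′) →
             length xs ≤ length ys
pigeonhole {xs = []} R _ _ _ = z≤n
pigeonhole {xs = x ∷ xs} R (x∉xs ∷ xs!) image inj with image (here refl)
... | y , y∈ys , Rxy with ∈-∃++ y∈ys
... | as , bs , refl = begin
  suc (length xs)               ≤⟨ s≤s (pigeonhole R xs! image′ inj) ⟩
  suc (length (as ++ bs))       ≡⟨ cong suc (List.length-++ as) ⟩
  suc (length as + length bs)   ≡⟨ ℕ.+-suc (length as) (length bs) ⟨
  length as + suc (length bs)   ≡⟨ List.length-++ as ⟨
  length (as ++ y ∷ bs)         ∎
  where
  open ℕ.≤-Reasoning
  image′ : ∀ {x′} → x′ ∈ˡ xs → ∃[ y′ ] y′ ∈ˡ as ++ bs × R x′ y′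
  image′ x′∈xs with image (there x′∈xs)
  ... | y′ , y′∈ys , Rx′y′ with ∈-++⁻ as y′∈ys
  ... | inj₁ y′∈as         = y′ , ∈-++⁺ˡ y′∈as , Rx′y′
  ... | inj₂ (here refl)   = contradiction (inj Rxy Rx′y′) (All.lookup x∉xs x′∈xs)
  ... | inj₂ (there y′∈bs) = y′ , ∈-++⁺ʳ as y′∈bs , Rx′y′

unique-length-≤ : ∀ {A : Set} {xs ys : List A} → Unique xs →
                  (∀ {x} → x ∈ˡ xs → x ∈ˡ ys) → length xs ≤ length ys
unique-length-≤ xs! xs⊆ys =
  pigeonhole _≡_ xs! (λ x∈xs → _ , xs⊆ys x∈xs , refl) (λ { refl refl → refl })

unique-length-≡ : ∀ {A : Set} {xs ys : List A} → Unique xs → Unique ys →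
                  (∀ {x} → x ∈ˡ xs → x ∈ˡ ys) → (∀ {x} → x ∈ˡ ys → x ∈ˡ xs) →
                  length xs ≡ length ys
unique-length-≡ xs! ys! xs⊆ys ys⊆xs =
  ℕ.≤-antisym (unique-length-≤ xs! xs⊆ys) (unique-length-≤ ys! ys⊆xs)

-- Extremal values and enumeration of finite sets

least : {P : ℕ → Set} → Decidable P → ∀ {k} → P k → ∃[ m ] IsMin P m
least P? {zero} p = 0 , p , λ _ _ → z≤n
least {P} P? {suc k} p with P? 0
... | yes p₀ = 0 , p₀ , λ _ _ → z≤n
... | no ¬p₀ with least (P? ∘ suc) {k} p
... | m , pm , m-min = suc m , pm , below
  where
  below : ∀ j → P j → suc m ≤ j
  below zero    p₀ = contradiction p₀ ¬p₀
  below (suc j) pj = s≤s (m-min j pj)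

greatest : {P : ℕ → Set} → Decidable P → ∀ N → (∀ k → P k → k ≤ N) →
           ∀ {k} → P k → ∃[ m ] IsMax P m
greatest {P} P? zero bound p = 0 , subst P (ℕ.n≤0⇒n≡0 (bound _ p)) p , bound
greatest {P} P? (suc N) bound p with P? (suc N)
... | yes pN = suc N , pN , bound
... | no ¬pN = greatest P? N bound′ p
  where
  bound′ : ∀ k → P k → k ≤ N
  bound′ k pk = ℕ.≤-pred (ℕ.≤∧≢⇒< (bound k pk) (λ { refl → ¬pN pk }))

argmin : ∀ {n} (f : Fin n → ℕ) → Fin n → ∃[ x ] ∀ y → f x ≤ f y
argmin f x₀ with least (λ k → Fin.any? (λ x → f x ℕ.≟ k)) (x₀ , refl)
... | _ , (x , refl) , x-min = x , λ y → x-min (f y) (y , refl)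

argmax : ∀ {n} (f : Fin n → ℕ) → Fin n → ∃[ x ] ∀ y → f y ≤ f x
argmax {suc zero}    f _ = zero , λ { zero → ℕ.≤-refl }
argmax {suc (suc n)} f _ with argmax (f ∘ suc) zero
... | x , x-max with ℕ.≤-total (f zero) (f (suc x))
... | inj₁ 0≤x = suc x , λ { zero → 0≤x ; (suc y) → x-max y }
... | inj₂ x≤0 = zero , λ { zero → ℕ.≤-refl ; (suc y) → ℕ.≤-trans (x-max y) x≤0 }

elements : ∀ {n} (S : Subset n) →
           ∃[ xs ] Unique xs × (∀ {x} → x ∈ˡ xs → x ∈ S) × (∀ {x} → x ∈ S → x ∈ˡ xs)
                 × length xs ≡ ∣ S ∣
elements Vec.[] = [] , [] , (λ ()) , (λ ()) , refl
elements (b Vec.∷ S) with elements S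
... | xs , xs! , ⊆S , S⊆ , ∣xs∣ = with-head b
  where
  suc-xs! : Unique (map suc xs)
  suc-xs! = Unique.map⁺ Fin.suc-injective xs!
  down : ∀ {b x} → x ∈ˡ map suc xs → x ∈ b Vec.∷ S
  down x∈ with ∈-map⁻ suc x∈
  ... | _ , y∈ , refl = Vec.there (⊆S y∈)
  up : ∀ {b x} → suc x ∈ b Vec.∷ S → suc x ∈ˡ map suc xs
  up (Vec.there x∈) = ∈-map⁺ suc (S⊆ x∈)
  ∣suc-xs∣ : length (map suc xs) ≡ ∣ S ∣
  ∣suc-xs∣ = trans (List.length-map suc xs) ∣xs∣
  zero∉ : ∀ {y} → y ∈ˡ map suc xs → zero ≢ y
  zero∉ y∈ refl with ∈-map⁻ suc y∈
  ... | _ , _ , ()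
  with-head : ∀ b → ∃[ xs ] Unique xs × (∀ {x} → x ∈ˡ xs → x ∈ b Vec.∷ S)
                  × (∀ {x} → x ∈ b Vec.∷ S → x ∈ˡ xs) × length xs ≡ ∣ b Vec.∷ S ∣
  with-head true = zero ∷ map suc xs , All.tabulate zero∉ ∷ suc-xs!
    , (λ { (here refl) → Vec.here ; (there x∈) → down x∈ })
    , (λ { {zero} _ → here refl ; {suc x} x∈ → there (up x∈) }) , cong suc ∣suc-xs∣
  with-head false = map suc xs , suc-xs! , down , (λ { {zero} () ; {suc x} x∈ → up x∈ }) , ∣suc-xs∣

comprehension : ∀ {n} {P : Fin n → Set} → Decidable P →
                ∃[ S ] (∀ {x} → x ∈ S → P x) × (∀ {x} → P x → x ∈ S)
comprehension {n} {P} P? = S , to , from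
  where
  S : Subset n
  S = Vec.tabulate (does ∘ P?)
  to : ∀ {x} → x ∈ S → P x
  to {x} x∈ with P? x | trans (sym (Vec.lookup∘tabulate (does ∘ P?) x)) (Vec.[]=⇒lookup x∈)
  ... | yes px | _ = px
  ... | no _   | ()
  from : ∀ {x} → P x → x ∈ S
  from {x} px = Vec.lookup⇒[]= x S (trans (Vec.lookup∘tabulate (does ∘ P?) x) (does-true (P? x) px))
    where
    does-true : ∀ {A : Set} (d : Dec A) → A → does d ≡ true
    does-true (yes _) _ = refl
    does-true (no ¬a) a = contradiction a ¬a

length-concat : ∀ {A : Set} (xss : List (List A)) → length (concat xss) ≡ sum (map length xss)
length-concat []         = refl
length-concat (xs ∷ xss) = trans (List.length-++ xs) (cong (length xs +_) (length-concat xss))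

-- Distances in trees

module _ {n : ℕ} {G : Graph n} where

  walk-∷ʳ : ∀ {u v w k} → Walk G u v k → Adj G v w → Walk G u w (suc k)
  walk-∷ʳ []      e = e ∷ []
  walk-∷ʳ (d ∷ p) e = d ∷ walk-∷ʳ p e

  walk-++ : ∀ {u v w j k} → Walk G u v j → Walk G v w k → Walk G u w (j + k)
  walk-++ []      q = q
  walk-++ (e ∷ p) q = e ∷ walk-++ p q

  walk-reverse : ∀ {u v k} → Walk G u v k → Walk G v u k
  walk-reverse []      = []
  walk-reverse (e ∷ p) = walk-∷ʳ (walk-reverse p) (adj-sym G e)

  adj⇒≢ : ∀ {u v} → Adj G u v → u ≢ v
  adj⇒≢ e refl = irrefl G e

module Distance {n : ℕ} (G : Graph n) (connected : ConnectedOn G ⊤) where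

  adj? : ∀ u v → Dec (Adj G u v)
  adj? u v = v ∈? nbrs G u

  walk? : ∀ k u v → Dec (Walk G u v k)
  walk? zero    u v = map′ (λ { refl → [] }) (λ { [] → refl }) (u Fin.≟ v)
  walk? (suc k) u v = map′ (λ (_ , e , p) → e ∷ p) (λ { (e ∷ p) → _ , e , p })
                           (Fin.any? λ w → adj? u w ×-dec walk? k w v)

  abstract
    distance : ∀ u v → ∃ (IsDist G u v)
    distance u v = least (λ k → walk? k u v) (proj₂ (connected ∈⊤ ∈⊤))

  dist : Fin n → Fin n → ℕ
  dist u v = proj₁ (distance u v)

  dist-isDist : ∀ u v → IsDist G u v (dist u v)
  dist-isDist u v = proj₂ (distance u v)

  dist-walk : ∀ u v → Walk G u v (dist u v)
  dist-walk u v = proj₁ (dist-isDist u v)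

  dist-≤ : ∀ {u v k} → Walk G u v k → dist u v ≤ k
  dist-≤ {u} {v} p = proj₂ (dist-isDist u v) _ p

  isDist⇒≡ : ∀ {u v k} → IsDist G u v k → dist u v ≡ k
  isDist⇒≡ {u} {v} (p , k-min) = ℕ.≤-antisym (dist-≤ p) (k-min _ (dist-walk u v))

  dist-refl : ∀ v → dist v v ≡ 0
  dist-refl v = ℕ.n≤0⇒n≡0 (dist-≤ [])

  dist≡0⇒≡ : ∀ {u v} → dist u v ≡ 0 → u ≡ v
  dist≡0⇒≡ {u} {v} d≡0 with subst (Walk G u v) d≡0 (dist-walk u v)
  ... | [] = refl

  dist-sym : ∀ u v → dist u v ≡ dist v u
  dist-sym u v = ℕ.≤-antisym (dist-≤ (walk-reverse (dist-walk v u)))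
                             (dist-≤ (walk-reverse (dist-walk u v)))

  dist-triangle : ∀ u v w → dist u w ≤ dist u v + dist v w
  dist-triangle u v w = dist-≤ (walk-++ (dist-walk u v) (dist-walk v w))

  dist-adj : ∀ {u w} → Adj G u w → ∀ x → dist u x ≤ suc (dist w x)
  dist-adj e x = dist-≤ (e ∷ dist-walk _ x)

  -- In a tree, the vertices x with Side v u x are those in the component of u
  -- after the edge vu is deleted.
  Side : Fin n → Fin n → Fin n → Set
  Side v u x = suc (dist u x) ≡ dist v x

  side? : ∀ v u → Decidable (Side v u)
  side? v u x = suc (dist u x) ℕ.≟ dist v x

  step : ∀ {u x k} → dist u x ≡ suc k → ∃[ w ] Adj G u w × dist w x ≡ k
  step {u} {x} d≡1+k with subst (Walk G u x) d≡1+k (dist-walk u x)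
  ... | e ∷ p = _ , e , ℕ.≤-antisym (dist-≤ p)
    (ℕ.≤-pred (ℕ.≤-trans (ℕ.≤-reflexive (sym d≡1+k)) (dist-adj e x)))

  dist-suc : ∀ {u x} → u ≢ x → ∃[ k ] dist u x ≡ suc k
  dist-suc {u} {x} u≢x with dist u x in eq
  ... | zero  = contradiction (dist≡0⇒≡ eq) u≢x
  ... | suc k = k , refl

  next : ∀ {u x} → u ≢ x → ∃[ w ] Adj G u w × Side u w x
  next u≢x with dist-suc u≢x
  ... | k , d≡1+k with step d≡1+k
  ... | w , e , d≡k = w , e , trans (cong suc d≡k) (sym d≡1+k)

  side-≢ : ∀ {v u x} → Side v u x → v ≢ x
  side-≢ {v} s refl with trans s (dist-refl v)
  ... | ()

  side-asym : ∀ {u v x} → Side u v x → ¬ Side v u x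
  side-asym {u} {v} {x} s t = ℕ.<-asym (ℕ.≤-reflexive s) (ℕ.≤-reflexive t)

  side-self : ∀ {v u} → Adj G v u → Side v u u
  side-self {v} {u} e with dist-suc (adj⇒≢ {G = G} e)
  ... | k , eq = ℕ.≤-antisym
    (ℕ.≤-trans (s≤s (ℕ.≤-reflexive (dist-refl u))) (ℕ.≤-trans (s≤s z≤n) (ℕ.≤-reflexive (sym eq))))
    (dist-adj e u)

module Tree {n : ℕ} (G : Graph n) (tree : IsTree G) where

  open Distance G (proj₁ tree) public

  Avoiding : Fin n → Fin n → Fin n → Set
  Avoiding u a b = Adj G a b × a ≢ u × b ≢ u

  avoiding-reverse : ∀ {u a b} → Star (Avoiding u) a b → Star (Avoiding u) b a
  avoiding-reverse = Star.reverse (λ (e , a≢u , b≢u) → adj-sym G e , b≢u , a≢u)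

  data PathTo (b : Fin n) : List (Fin n) → Set where
    stop : PathTo b (b ∷ [])
    _∷_  : ∀ {a a′ xs} → Adj G a a′ → PathTo b (a′ ∷ xs) → PathTo b (a ∷ a′ ∷ xs)

  SimpleAvoiding : Fin n → Fin n → Fin n → Set
  SimpleAvoiding u a b =
    ∃[ ys ] PathTo b (a ∷ ys) × Unique (a ∷ ys) × All (u ≢_) (a ∷ ys)

  path-from : ∀ {u a b xs} → a ∈ˡ xs → PathTo b xs → Unique xs → All (u ≢_) xs →
              SimpleAvoiding u a b
  path-from (here refl)         stop    xs!        u∉       = [] , stop , xs! , u∉
  path-from (here refl)         (e ∷ p) xs!        u∉       = _ , e ∷ p , xs! , u∉
  path-from (there a∈)          (e ∷ p) (_ ∷ xs!)  (_ ∷ u∉) = path-from a∈ p xs! u∉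

  -- Loop erasure: if `a` recurs on the simple path found for the rest, that path is cut at the
  -- recurrence; otherwise `a` is prepended.
  simplify : ∀ {u a b} → u ≢ a → Star (Avoiding u) a b → SimpleAvoiding u a b
  simplify u≢a ε = [] , stop , [] ∷ [] , u≢a ∷ []
  simplify {a = a} u≢a (_◅_ {j = a′} (e , _ , a′≢u) r) with simplify (a′≢u ∘ sym) r
  ... | ys , p , ys! , u∉ with any? (a Fin.≟_) (a′ ∷ ys)
  ... | yes a∈ = path-from a∈ p ys! u∉
  ... | no a∉  = a′ ∷ ys , e ∷ p , All.¬Any⇒All¬ _ a∉ ∷ ys! , u≢a ∷ u∉

  path-linked : ∀ {b u xs} → PathTo b xs → Adj G b u → Linked (Adj G) (xs ∷ʳ u)
  path-linked stop    e = e ∷ [-]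
  path-linked (d ∷ p) e = d ∷ path-linked p e

  -- A simple path between two neighbours of `u` that misses `u` closes up through `u` to a cycle.
  no-avoiding : ∀ {u w w′} → Adj G u w → Adj G u w′ → w ≢ w′ → ¬ Star (Avoiding u) w w′
  no-avoiding e e′ w≢w′ r with simplify (adj⇒≢ {G = G} e) r
  ... | []     , stop , _   , _  = w≢w′ refl
  ... | y ∷ ys , p    , ys! , u∉ =
    proj₂ tree _ _ (s≤s (s≤s z≤n) , u∉ ∷ ys! , e ∷ path-linked p (adj-sym G e′))

  -- The distance to `x` drops at each step of a geodesic, so every vertex after `w` is strictly
  -- closer to `x` than `u` is, and `u` is never met.
  geodesic-avoiding : ∀ k {u w x} → dist w x ≡ k → dist w x ≤ dist u x → w ≢ u →
                      Star (Avoiding u) w x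
  geodesic-avoiding zero    d≡0 _ _ rewrite dist≡0⇒≡ d≡0 = ε
  geodesic-avoiding (suc k) {u} {w} {x} d≡1+k w≤u w≢u with step d≡1+k
  ... | w₁ , e , d₁≡k = (e , w≢u , w₁≢u) ◅ geodesic-avoiding k d₁≡k (ℕ.<⇒≤ w₁<u) w₁≢u
    where
    w₁<u : dist w₁ x < dist u x
    w₁<u = subst₂ _≤_ (trans d≡1+k (cong suc (sym d₁≡k))) refl w≤u
    w₁≢u : w₁ ≢ u
    w₁≢u refl = ℕ.<-irrefl refl w₁<u

  -- Both neighbours reach `x` while avoiding `u`, so distinct ones would contradict `no-avoiding`.
  -- The inequalities are weak so that `side-total` can also exclude ties.
  closer-unique : ∀ {u w w′ x} → Adj G u w → Adj G u w′ →
                  dist w x ≤ dist u x → dist w′ x ≤ dist u x → w ≡ w′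
  closer-unique {u} {w} {w′} e e′ w≤u w′≤u with w Fin.≟ w′
  ... | yes w≡w′ = w≡w′
  ... | no  w≢w′ = contradiction
    (geodesic-avoiding _ refl w≤u (adj⇒≢ {G = G} e ∘ sym)
      ◅◅ avoiding-reverse (geodesic-avoiding _ refl w′≤u (adj⇒≢ {G = G} e′ ∘ sym)))
    (no-avoiding e e′ w≢w′)

  side-≤ : ∀ {v u x} → Side v u x → dist u x ≤ dist v x
  side-≤ s = ℕ.<⇒≤ (ℕ.≤-reflexive s)

  side-unique : ∀ {u w w′ x} → Adj G u w → Adj G u w′ → Side u w x → Side u w′ x → w ≡ w′
  side-unique e e′ s s′ = closer-unique e e′ (side-≤ s) (side-≤ s′)

  -- Trees are bipartite: in a tie, `w` and the next vertex on a geodesic from `u` to `x` would both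
  -- be no farther from `x` than `u`, hence equal by `closer-unique`.
  side-total : ∀ {u w} → Adj G u w → ∀ x → Side u w x ⊎ Side w u x
  side-total {u} {w} e x with ℕ.<-cmp (dist u x) (dist w x)
  ... | tri< u<w _ _ = inj₂ (ℕ.≤-antisym u<w (dist-adj (adj-sym G e) x))
  ... | tri> _ _ w<u = inj₁ (ℕ.≤-antisym w<u (dist-adj e x))
  ... | tri≈ _ u≈w _ with u Fin.≟ x
  ...   | yes refl = contradiction (sym (dist≡0⇒≡ (trans (sym u≈w) (dist-refl u)))) (adj⇒≢ {G = G} e)
  ...   | no u≢x with next u≢x
  ...     | w′ , e′ , s with closer-unique e e′ (ℕ.≤-reflexive (sym u≈w)) (side-≤ s)
  ...       | refl = inj₁ s

  side-flip : ∀ {u w} → Adj G u w → ∀ {x} → ¬ Side u w x → Side w u x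
  side-flip e ¬s = [ (λ s → contradiction s ¬s) , id ]′ (side-total e _)

  side-other : ∀ {u v w} → Adj G u v → Adj G u w → v ≢ w → ∀ {x} → Side u w x → Side v u x
  side-other e e′ v≢w s = side-flip e λ s′ → v≢w (side-unique e e′ s′ s)

  -- The hypothesis says that `m` separates `a` from `b`; it holds vacuously if one of them is `m`.
  -- The induction moves `a` one step toward `m`, to `a₁`. Suppose that `b` is closer to `a` than to
  -- `a₁`. If `a₁ = m`, then `a` is a neighbour of `m` leading to both. Otherwise the next vertex
  -- `a₂` toward `m` is no farther from `b` than `a₁`, so `a = a₂` by `closer-unique`, although `a₂`
  -- is nearer to `m` than `a₁` and `a` is not.
  dist-through : ∀ {m a b} → (∀ {w} → Adj G m w → Side m w a → ¬ Side m w b) →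
                 dist a b ≡ dist a m + dist m b
  dist-through {m} {b = b} = go _ refl
    where
    go : ∀ k {a} → dist a m ≡ k → (∀ {w} → Adj G m w → Side m w a → ¬ Side m w b) →
         dist a b ≡ dist a m + dist m b
    go zero {a} d≡0 _ rewrite dist≡0⇒≡ d≡0 | dist-refl m = refl
    go (suc k) {a} d≡1+k apart with step d≡1+k
    ... | a₁ , e , d₁≡k = finish (side-total e b)
      where
      -- A neighbour of `m` toward `a₁` is also toward `a`, because `a₁` lies on a geodesic from `a`
      -- to `m`.
      apart₁ : ∀ {w} → Adj G m w → Side m w a₁ → ¬ Side m w b
      apart₁ {w} f s = apart f (ℕ.≤-antisym
        (begin
          suc (dist w a)        ≡⟨ cong suc (dist-sym w a) ⟩
          suc (dist a w)        ≤⟨ s≤s (dist-adj e w) ⟩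
          suc (suc (dist a₁ w)) ≡⟨ cong (2 +_) (dist-sym a₁ w) ⟩
          suc (suc (dist w a₁)) ≡⟨ cong suc s ⟩
          suc (dist m a₁)       ≡⟨ cong suc (trans (dist-sym m a₁) d₁≡k) ⟩
          suc k                 ≡⟨ trans (dist-sym m a) d≡1+k ⟨
          dist m a              ∎)
        (dist-adj f a))
        where open ℕ.≤-Reasoning
      d₁ : dist a₁ b ≡ k + dist m b
      d₁ = trans (go k d₁≡k apart₁) (cong (_+ dist m b) d₁≡k)
      finish : Side a a₁ b ⊎ Side a₁ a b → dist a b ≡ dist a m + dist m b
      finish (inj₁ s) = trans (sym s) (trans (cong suc d₁) (cong (_+ dist m b) (sym d≡1+k)))
      finish (inj₂ s) with a₁ Fin.≟ m
      ... | yes refl = contradiction s (apart (adj-sym G e)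
              (trans (cong suc (dist-refl a)) (trans (sym (trans d≡1+k (cong suc (trans (sym d₁≡k) (dist-refl m))))) (dist-sym a m))))
      ... | no a₁≢m with next a₁≢m
      ...   | a₂ , f , s₂ = contradiction d≡1+k (ℕ.<⇒≢ (begin-strict
              dist a m   ≡⟨ cong (λ z → dist z m) a≡a₂ ⟩
              dist a₂ m  <⟨ ℕ.≤-reflexive s₂ ⟩
              dist a₁ m  ≡⟨ d₁≡k ⟩
              k          <⟨ ℕ.≤-refl ⟩
              suc k      ∎))
        where
        open ℕ.≤-Reasoning
        a≡a₂ : a ≡ a₂
        a≡a₂ = closer-unique (adj-sym G e) f (side-≤ s) (begin
          dist a₂ b             ≤⟨ dist-triangle a₂ m b ⟩
          dist a₂ m + dist m b  ≤⟨ ℕ.+-monoˡ-≤ (dist m b) (side-≤ s₂) ⟩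
          dist a₁ m + dist m b  ≡⟨ cong (_+ dist m b) d₁≡k ⟩
          k + dist m b          ≡⟨ d₁ ⟨
          dist a₁ b             ∎)

  side-farther : ∀ {v u x y} → Adj G v u → Side v u x → Adj G x y →
                 suc (dist v x) ≡ dist v y → Side v u y
  side-farther {v} {u} {x} {y} e s f farther = ℕ.≤-antisym (begin
    suc (dist u y)       ≡⟨ cong suc (dist-sym u y) ⟩
    suc (dist y u)       ≤⟨ s≤s (dist-adj (adj-sym G f) u) ⟩
    suc (suc (dist x u)) ≡⟨ cong (2 +_) (dist-sym x u) ⟩
    suc (suc (dist u x)) ≡⟨ cong suc s ⟩
    suc (dist v x)       ≡⟨ farther ⟩
    dist v y             ∎) (dist-adj e y)
    where open ℕ.≤-Reasoning

  dist-step : ∀ v {x y} → Adj G x y → suc (dist v x) ≡ dist v y ⊎ suc (dist v y) ≡ dist v x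
  dist-step v {x} {y} f = [ inj₂ ∘ flip-ends , inj₁ ∘ flip-ends ]′ (side-total f v)
    where
    flip-ends : ∀ {a b} → Side a b v → suc (dist v b) ≡ dist v a
    flip-ends {a} {b} s = trans (cong suc (dist-sym v b)) (trans s (dist-sym a v))

  -- A side can be left only through `v`. A step away from `v` keeps the side by `side-farther`; a
  -- step toward `v` is the reverse of such a step, taken from the side that contains `y`.
  side-adj : ∀ {v u x y} → Adj G v u → Side v u x → Adj G x y → v ≢ y → Side v u y
  side-adj {v} e s f v≢y with dist-step v f
  ... | inj₁ farther = side-farther e s f farther
  ... | inj₂ closer with next v≢y
  ... | w , e′ , s′ with side-unique e e′ s (side-farther e′ s′ (adj-sym G f) closer)
  ... | refl = s′

-- Sides of edges and their sizes

module Sizes {n : ℕ} (G : Graph n) (tree : IsTree G) where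

  open Tree G tree public

  side : Fin n → Fin n → List (Fin n)
  side v u = filter (side? v u) (allFin n)

  size : Fin n → Fin n → ℕ
  size v u = length (side v u)

  ∈-side⁺ : ∀ {v u x} → Side v u x → x ∈ˡ side v u
  ∈-side⁺ {v} {u} {x} = ∈-filter⁺ (side? v u) (∈-allFin x)

  ∈-side⁻ : ∀ {v u x} → x ∈ˡ side v u → Side v u x
  ∈-side⁻ {v} {u} x∈ = proj₂ (∈-filter⁻ (side? v u) {xs = allFin n} x∈)

  side! : ∀ v u → Unique (side v u)
  side! v u = Unique.filter⁺ (side? v u) (Unique.allFin⁺ n)

  size-≤ : ∀ v u → size v u ≤ n
  size-≤ v u = ℕ.≤-trans (List.length-filter (side? v u) (allFin n))
                         (ℕ.≤-reflexive (List.length-tabulate id))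

  size-complement : ∀ {u v} → Adj G u v → n ≡ size u v + size v u
  size-complement {u} {v} e = begin
    n                              ≡⟨ List.length-tabulate {n = n} id ⟨
    length (allFin n)              ≡⟨ unique-length-≡ (Unique.allFin⁺ n) (Unique.++⁺ (side! u v) (side! v u) disjoint) (λ {x} _ → covered x) (λ _ → ∈-allFin _) ⟩
    length (side u v ++ side v u)  ≡⟨ List.length-++ (side u v) ⟩
    size u v + size v u            ∎
    where
    open ≡-Reasoning
    disjoint : ∀ {x} → ¬ (x ∈ˡ side u v × x ∈ˡ side v u)
    disjoint (x∈ , x∈′) = side-asym (∈-side⁻ x∈) (∈-side⁻ x∈′)
    covered : ∀ x → x ∈ˡ side u v ++ side v u
    covered x = [ ∈-++⁺ˡ ∘ ∈-side⁺ , ∈-++⁺ʳ (side u v) ∘ ∈-side⁺ ]′ (side-total e x)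

  size-mono : ∀ {u v w} → Adj G u v → Adj G u w → v ≢ w → suc (size u w) ≤ size v u
  size-mono {u} {v} {w} e e′ v≢w = unique-length-≤ (All.tabulate u∉ ∷ side! u w) included
    where
    u∉ : ∀ {x} → x ∈ˡ side u w → u ≢ x
    u∉ x∈ = side-≢ (∈-side⁻ x∈)
    included : ∀ {x} → x ∈ˡ u ∷ side u w → x ∈ˡ side v u
    included (here refl) = ∈-side⁺ (side-self (adj-sym G e))
    included (there x∈)  = ∈-side⁺ (side-other e e′ v≢w (∈-side⁻ x∈))

  record Children (v u : Fin n) (ws : List (Fin n)) : Set where
    field
      parent   : Adj G u v
      unique   : Unique (v ∷ ws)
      adjacent : ∀ {w} → w ∈ˡ ws → Adj G u w
      complete : ∀ {w} → Adj G u w → v ≢ w → w ∈ˡ ws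

    not-parent : ∀ {w} → w ∈ˡ ws → v ≢ w
    not-parent = All.lookup (AllPairs.head unique)

  children : ∀ {v u} → Adj G u v → ∃[ ws ] Children v u ws × suc (length ws) ≡ degree G u
  children {v} {u} e with elements (nbrs G u)
  ... | xs , xs! , ⊆N , N⊆ , ∣xs∣ = ws , record
    { parent   = e
    ; unique   = All.tabulate (λ w∈ → ws≢v w∈ ∘ sym) ∷ ws!
    ; adjacent = λ w∈ → ⊆N (proj₁ (∈-filter⁻ other? {xs = xs} w∈))
    ; complete = λ f v≢w → ∈-filter⁺ other? (N⊆ f) (v≢w ∘ sym)
    } , trans (unique-length-≡ (All.tabulate (λ w∈ → ws≢v w∈ ∘ sym) ∷ ws!) xs! to from) ∣xs∣
    where
    other? : Decidable (_≢ v)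
    other? x with x Fin.≟ v
    ... | yes x≡v = no λ x≢v → x≢v x≡v
    ... | no  x≢v = yes x≢v
    ws : List (Fin n)
    ws = filter other? xs
    ws! : Unique ws
    ws! = Unique.filter⁺ other? xs!
    ws≢v : ∀ {w} → w ∈ˡ ws → w ≢ v
    ws≢v w∈ = proj₂ (∈-filter⁻ other? {xs = xs} w∈)
    to : ∀ {x} → x ∈ˡ v ∷ ws → x ∈ˡ xs
    to (here refl) = N⊆ e
    to (there x∈)  = proj₁ (∈-filter⁻ other? {xs = xs} x∈)
    from : ∀ {x} → x ∈ˡ xs → x ∈ˡ v ∷ ws
    from {x} x∈ with x Fin.≟ v
    ... | yes refl = here refl
    ... | no x≢v   = there (∈-filter⁺ other? x∈ x≢v)

  module _ {v u ws} (ch : Children v u ws) where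
    open Children ch

    side-child : ∀ {x} → Side v u x → x ≢ u → ∃[ w ] w ∈ˡ ws × Side u w x
    side-child {x} s x≢u with next (x≢u ∘ sym)
    ... | w , e , t = w , complete e v≢w , t
      where
      v≢w : v ≢ w
      v≢w refl = side-asym s t

    side-descendant : ∀ {w} → w ∈ˡ ws → ∀ {x} → Side u w x → Side v u x
    side-descendant w∈ = side-other parent (adjacent w∈) (not-parent w∈)

    size-children : size v u ≡ suc (sum (map (size u) ws))
    size-children = trans
      (unique-length-≡ (side! v u) below! to from)
      (cong suc (trans (length-concat (map (side u) ws)) (cong sum (sym (List.map-∘ ws)))))
      where
      below : List (Fin n)
      below = concat (map (side u) ws)
      below⁻ : ∀ {x} → x ∈ˡ below → ∃[ w ] w ∈ˡ ws × Side u w x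
      below⁻ x∈ with ∈-concat⁻′ (map (side u) ws) x∈
      ... | _ , x∈s , s∈ with ∈-map⁻ (side u) s∈
      ... | w , w∈ , refl = w , w∈ , ∈-side⁻ x∈s
      disjoint : ∀ {ys} → Unique ys → (∀ {w} → w ∈ˡ ys → Adj G u w) →
                 AllPairs (λ a b → ∀ {x} → ¬ (x ∈ˡ side u a × x ∈ˡ side u b)) ys
      disjoint [] _ = []
      disjoint (y∉ ∷ ys!) adj = All.tabulate (λ w∈ (x∈ , x∈′) → All.lookup y∉ w∈
          (side-unique (adj (here refl)) (adj (there w∈)) (∈-side⁻ x∈) (∈-side⁻ x∈′)))
        ∷ disjoint ys! (adj ∘ there)
      below! : Unique (u ∷ below)
      below! = All.tabulate (λ x∈ → side-≢ (proj₂ (proj₂ (below⁻ x∈))))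
        ∷ Unique.concat⁺ (All.map⁺ (All.universal (side! u) ws))
                         (AllPairs.map⁺ (disjoint (AllPairs.tail unique) adjacent))
      to : ∀ {x} → x ∈ˡ side v u → x ∈ˡ u ∷ below
      to {x} x∈ with x Fin.≟ u
      ... | yes refl = here refl
      ... | no x≢u with side-child (∈-side⁻ x∈) x≢u
      ... | w , w∈ , s = there (∈-concat⁺′ (∈-side⁺ s) (∈-map⁺ (side u) w∈))
      from : ∀ {x} → x ∈ˡ u ∷ below → x ∈ˡ side v u
      from (here refl) = ∈-side⁺ (side-self (adj-sym G parent))
      from (there x∈) with below⁻ x∈
      ... | w , w∈ , s = ∈-side⁺ (side-descendant w∈ s)

-- Branches and weights

∣S∣≡1⇒≡ : ∀ {n} {S : Subset n} → ∣ S ∣ ≡ 1 → ∀ {x y} → x ∈ S → y ∈ S → x ≡ y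
∣S∣≡1⇒≡ {S = S} ∣S∣≡1 x∈S y∈S with elements S
... | xs , _ , _ , S⊆ , ∣xs∣ with xs | trans ∣xs∣ ∣S∣≡1 | S⊆ x∈S | S⊆ y∈S
... | _ ∷ [] | _ | here refl | here refl = refl

∣S∣≡1⇒∃ : ∀ {n} {S : Subset n} → ∣ S ∣ ≡ 1 → ∃[ x ] x ∈ S
∣S∣≡1⇒∃ {S = S} ∣S∣≡1 with elements S
... | xs , _ , ⊆S , _ , ∣xs∣ with xs | trans ∣xs∣ ∣S∣≡1 | (λ {x} → ⊆S {x})
... | x ∷ [] | _ | ⊆S′ = x , ⊆S′ (here refl)

∃!⇒∣S∣≡1 : ∀ {n} {S : Subset n} {x} → x ∈ S → (∀ {y} → y ∈ S → y ≡ x) → ∣ S ∣ ≡ 1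
∃!⇒∣S∣≡1 {S = S} {x} x∈S only-x with elements S
... | xs , xs! , ⊆S , S⊆ , ∣xs∣ = trans (sym ∣xs∣)
  (unique-length-≡ xs! ([] ∷ []) (λ y∈ → here (only-x (⊆S y∈))) (λ { (here refl) → S⊆ x∈S }))

module _ {n : ℕ} (H : Graph n) where

  edgeList : List (Fin n × Fin n)
  edgeList = filter (λ (u , v) → u Fin.<? v ×-dec v ∈? nbrs H u)
                    (cartesianProduct (allFin n) (allFin n))

  edgeList! : Unique edgeList
  edgeList! = Unique.filter⁺ _ (Unique.cartesianProduct⁺ (Unique.allFin⁺ n) (Unique.allFin⁺ n))

  ∈-edgeList⁺ : ∀ {a b} → a Fin.< b → Adj H a b → (a , b) ∈ˡ edgeList
  ∈-edgeList⁺ a<b e = ∈-filter⁺ (λ (u , v) → u Fin.<? v ×-dec v ∈? nbrs H u)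
    (∈-cartesianProduct⁺ (∈-allFin _) (∈-allFin _)) (a<b , e)

  ∈-edgeList⁻ : ∀ {a b} → (a , b) ∈ˡ edgeList → a Fin.< b × Adj H a b
  ∈-edgeList⁻ ab∈ = proj₂ (∈-filter⁻ (λ (u , v) → u Fin.<? v ×-dec v ∈? nbrs H u)
                                     {xs = cartesianProduct (allFin n) (allFin n)} ab∈)

numEdges-cong : ∀ {n} {H K : Graph n} → (∀ {u v} → Adj H u v → Adj K u v) →
                (∀ {u v} → Adj K u v → Adj H u v) → numEdges H ≡ numEdges K
numEdges-cong {H = H} {K} H⊆K K⊆H =
  unique-length-≡ (edgeList! H) (edgeList! K)
    (transport {H} {K} H⊆K) (transport {K} {H} K⊆H)
  where
  transport : ∀ {H K} → (∀ {u v} → Adj H u v → Adj K u v) →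
              ∀ {ab} → ab ∈ˡ edgeList H → ab ∈ˡ edgeList K
  transport {H} {K} H⊆K ab∈ with ∈-edgeList⁻ H ab∈
  ... | a<b , e = ∈-edgeList⁺ K a<b (H⊆K e)

module Branch {n : ℕ} (G : Graph n) (tree : IsTree G) {v u : Fin n} (e : Adj G v u) where

  open Sizes G tree
  open Subgraph

  In : Fin n → Set
  In x = x ≡ v ⊎ Side v u x

  in? : Decidable In
  in? x = (x Fin.≟ v) ⊎-dec side? v u x

  branch-nbrs : ∀ a → ∃[ S ] (∀ {b} → b ∈ S → In a × In b × Adj G a b)
                           × (∀ {b} → In a × In b × Adj G a b → b ∈ S)
  branch-nbrs a = comprehension (λ b → in? a ×-dec in? b ×-dec adj? a b)

  branch-verts : ∃[ S ] (∀ {x} → x ∈ S → In x) × (∀ {x} → In x → x ∈ S)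
  branch-verts = comprehension in?

  edge⁻ : ∀ {a b} → b ∈ proj₁ (branch-nbrs a) → In a × In b × Adj G a b
  edge⁻ {a} = proj₁ (proj₂ (branch-nbrs a))

  edge⁺ : ∀ {a b} → In a → In b → Adj G a b → b ∈ proj₁ (branch-nbrs a)
  edge⁺ {a} ia ib f = proj₂ (proj₂ (branch-nbrs a)) (ia , ib , f)

  vert⁻ : ∀ {x} → x ∈ proj₁ branch-verts → In x
  vert⁻ = proj₁ (proj₂ branch-verts)

  vert⁺ : ∀ {x} → In x → x ∈ proj₁ branch-verts
  vert⁺ = proj₂ (proj₂ branch-verts)

  branch : Subgraph G
  branch = record
    { verts   = proj₁ branch-verts
    ; edges   = record
      { nbrs   = λ a → proj₁ (branch-nbrs a)
      ; sym    = λ ab → let (ia , ib , f) = edge⁻ ab in edge⁺ ib ia (adj-sym G f)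
      ; irrefl = λ aa → irrefl G (proj₂ (proj₂ (edge⁻ aa)))
      }
    ; edges⊆  = λ ab → proj₂ (proj₂ (edge⁻ ab))
    ; edges-∈ = λ ab → vert⁺ (proj₁ (edge⁻ ab))
    }

  toward-root : ∀ {x} → Side v u x → ∃[ p ] In p × Adj G x p × suc (dist v p) ≡ dist v x
  toward-root {x} s with next (side-≢ s ∘ sym)
  ... | p , f , t = p , in-p , f , trans (cong suc (dist-sym v p)) (trans t (dist-sym x v))
    where
    in-p : In p
    in-p with p Fin.≟ v
    ... | yes p≡v = inj₁ p≡v
    ... | no p≢v  = inj₂ (side-adj e s f (p≢v ∘ sym))

  walk-to-root : ∀ k {x} → dist v x ≡ k → In x → ∃[ j ] Walk (edges branch) x v j
  walk-to-root _ _ (inj₁ refl) = 0 , []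
  walk-to-root zero    d≡0 (inj₂ s) = contradiction (dist≡0⇒≡ d≡0) (side-≢ s)
  walk-to-root (suc k) d≡1+k (inj₂ s) with toward-root s
  ... | p , in-p , f , closer with walk-to-root k (ℕ.suc-injective (trans closer d≡1+k)) in-p
  ... | j , w = suc j , edge⁺ (inj₂ s) in-p f ∷ w

  branch-subtree : IsSubtree branch
  branch-subtree = connected , acyclic
    where
    connected : ConnectedOn (edges branch) (verts branch)
    connected x∈ y∈ with walk-to-root _ refl (vert⁻ x∈) | walk-to-root _ refl (vert⁻ y∈)
    ... | _ , p | _ , q = _ , walk-++ p (walk-reverse q)
    acyclic : Acyclic (edges branch)
    acyclic x xs (2≤ , xs! , linked) =
      proj₂ tree x xs (2≤ , xs! , Linked.map (edges⊆ branch) linked)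

  branch-pendant : IsSubtreePendantAt v branch
  branch-pendant = branch-subtree , vert⁺ (inj₁ refl)
                 , ∃!⇒∣S∣≡1 (edge⁺ (inj₁ refl) (inj₂ (side-self e)) e) only-u
    where
    only-u : ∀ {b} → b ∈ proj₁ (branch-nbrs v) → b ≡ u
    only-u b∈ with edge⁻ b∈
    ... | _ , inj₁ refl , f = contradiction f (irrefl G)
    ... | _ , inj₂ s    , f = side-unique f e (side-self f) s

  -- A walk in `H` that starts at `v` stays within `In`: from `v` its only edge leads to `u`, and
  -- the `u`-side can be left only through `v`.
  pendant⊑branch : ∀ {H} → IsSubtreePendantAt v H → Adj (edges H) v u → H ⊑ branch
  pendant⊑branch {H} ((connected , _) , v∈H , pendant) vu =
    vert⁺ ∘ in-H , λ f → edge⁺ (in-H (edges-∈ H f)) (in-H (edges-∈ H (adj-sym (edges H) f))) (edges⊆ H f)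
    where
    stay : ∀ {x y k} → Walk (edges H) x y k → In x → In y
    stay [] i = i
    stay (f ∷ p) (inj₁ refl) with ∣S∣≡1⇒≡ pendant vu f
    ... | refl = stay p (inj₂ (side-self e))
    stay (_∷_ {v = y} f p) (inj₂ s) with y Fin.≟ v
    ... | yes y≡v = stay p (inj₁ y≡v)
    ... | no y≢v  = stay p (inj₂ (side-adj e s (edges⊆ H f) (y≢v ∘ sym)))
    in-H : ∀ {x} → x ∈ verts H → In x
    in-H x∈ = stay (proj₂ (connected v∈H x∈)) (inj₁ refl)

  branch-isBranch : IsBranch v branch
  branch-isBranch = branch-pendant , λ H pendant B⊑H →
    pendant⊑branch {H = H} pendant (proj₂ B⊑H (edge⁺ (inj₁ refl) (inj₂ (side-self e)) e))

  -- Every edge of the branch is counted by its end farther from v.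
  numEdges-branch : numEdges (edges branch) ≡ size v u
  numEdges-branch = ℕ.≤-antisym
    (pigeonhole FarEnd (edgeList! (edges branch)) far-end edge-unique)
    (pigeonhole (flip FarEnd) (side! v u) far-edge far-end-unique)
    where
    FarEnd : Fin n × Fin n → Fin n → Set
    FarEnd (a , b) x = a Fin.< b × Adj G a b ×
      ((x ≡ b × suc (dist v a) ≡ dist v b) ⊎ (x ≡ a × suc (dist v b) ≡ dist v a))

    in-far : ∀ {a b} → In b → suc (dist v a) ≡ dist v b → b ∈ˡ side v u
    in-far (inj₂ s) _ = ∈-side⁺ s
    in-far (inj₁ refl) eq with trans eq (dist-refl v)
    ... | ()

    far-end : ∀ {ab} → ab ∈ˡ edgeList (edges branch) → ∃[ x ] x ∈ˡ side v u × FarEnd ab x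
    far-end ab∈ with ∈-edgeList⁻ (edges branch) ab∈
    ... | a<b , f with edge⁻ f
    ... | in-a , in-b , g with dist-step v g
    ... | inj₁ eq = _ , in-far in-b eq , a<b , g , inj₁ (refl , eq)
    ... | inj₂ eq = _ , in-far in-a eq , a<b , g , inj₂ (refl , eq)

    far-edge : ∀ {x} → x ∈ˡ side v u →
               ∃[ ab ] ab ∈ˡ edgeList (edges branch) × FarEnd ab x
    far-edge {x} x∈ with toward-root (∈-side⁻ x∈)
    ... | p , in-p , f , eq with Fin.<-cmp x p
    ... | tri≈ _ x≡p _ = contradiction x≡p (adj⇒≢ {G = G} f)
    ... | tri< x<p _ _ = (x , p) , ∈-edgeList⁺ (edges branch) x<p (edge⁺ (inj₂ (∈-side⁻ x∈)) in-p f)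
                       , x<p , f , inj₂ (refl , eq)
    ... | tri> _ _ p<x = (p , x) , ∈-edgeList⁺ (edges branch) p<x (edge⁺ in-p (inj₂ (∈-side⁻ x∈)) (adj-sym G f))
                       , p<x , adj-sym G f , inj₁ (refl , eq)

    near-unique : ∀ {x p p′} → Adj G x p → Adj G x p′ →
                  suc (dist v p) ≡ dist v x → suc (dist v p′) ≡ dist v x → p ≡ p′
    near-unique {x} f f′ eq eq′ = side-unique f f′ (near eq) (near eq′)
      where
      near : ∀ {p} → suc (dist v p) ≡ dist v x → Side x p v
      near {p} eq = trans (cong suc (dist-sym p v)) (trans eq (dist-sym v x))

    edge-unique : ∀ {ab ab′ x} → FarEnd ab x → FarEnd ab′ x → ab ≡ ab′
    edge-unique (_ , f , inj₁ (refl , eq)) (_ , f′ , inj₁ (refl , eq′)) =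
      cong (_, _) (near-unique (adj-sym G f) (adj-sym G f′) eq eq′)
    edge-unique (_ , f , inj₂ (refl , eq)) (_ , f′ , inj₂ (refl , eq′)) =
      cong (_ ,_) (near-unique f f′ eq eq′)
    edge-unique (a<b , f , inj₁ (refl , eq)) (a′<b′ , f′ , inj₂ (refl , eq′))
      with near-unique (adj-sym G f) f′ eq eq′
    ... | refl = contradiction a<b (Fin.<-asym a′<b′)
    edge-unique (a<b , f , inj₂ (refl , eq)) (a′<b′ , f′ , inj₁ (refl , eq′))
      with near-unique f (adj-sym G f′) eq eq′
    ... | refl = contradiction a<b (Fin.<-asym a′<b′)

    far-end-unique : ∀ {x x′ ab} → FarEnd ab x → FarEnd ab x′ → x ≡ x′
    far-end-unique (_ , _ , inj₁ (refl , _)) (_ , _ , inj₁ (refl , _)) = refl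
    far-end-unique (_ , _ , inj₂ (refl , _)) (_ , _ , inj₂ (refl , _)) = refl
    far-end-unique (_ , _ , inj₁ (refl , eq)) (_ , _ , inj₂ (refl , eq′)) =
      contradiction (ℕ.≤-reflexive eq′) (ℕ.<-asym (ℕ.≤-reflexive eq))
    far-end-unique (_ , _ , inj₂ (refl , eq)) (_ , _ , inj₁ (refl , eq′)) =
      contradiction (ℕ.≤-reflexive eq′) (ℕ.<-asym (ℕ.≤-reflexive eq))

module Weights {n : ℕ} (G : Graph n) (tree : IsTree G) where

  open Sizes G tree public
  open Subgraph

  -- The single edge of `B` at `v` selects `u`, and maximality turns the inclusion of `B` in the
  -- full `u`-branch into equality.
  branch-size : ∀ {v} (B : Subgraph G) → IsBranch v B →
                ∃[ u ] Adj G v u × numEdges (edges B) ≡ size v u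
  branch-size {v} B (pendant@(_ , _ , deg≡1) , maximal) with ∣S∣≡1⇒∃ deg≡1
  ... | u , f = u , e , trans (numEdges-cong {H = edges B} {edges branch} (proj₂ B⊑branch) (proj₂ branch⊑B)) numEdges-branch
    where
    e : Adj G v u
    e = edges⊆ B f
    open Branch G tree e
    B⊑branch : B ⊑ branch
    B⊑branch = pendant⊑branch {H = B} pendant f
    branch⊑B : branch ⊑ B
    branch⊑B = maximal branch branch-pendant B⊑branch

  HasSide : Fin n → ℕ → Set
  HasSide v k = ∃[ u ] Adj G v u × size v u ≡ k

  -- This trades a maximum over all subgraphs for one over the neighbours of `v`, which can be
  -- computed.
  hasSide⇒weight : ∀ {v k} → IsMax (HasSide v) k → IsWeight G v k
  hasSide⇒weight {v} {k} ((u , e , size≡k) , k-max) =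
    (branch , branch-isBranch , trans numEdges-branch size≡k) , bound
    where
    open Branch G tree e
    bound : ∀ j → Σ (Subgraph G) (λ B → IsBranch v B × numEdges (edges B) ≡ j) → j ≤ k
    bound j (B , isB , edges≡j) =
      let w , f , edges≡size = branch-size B isB
      in k-max j (w , f , trans (sym edges≡size) edges≡j)

IsMax-unique : ∀ {P : ℕ → Set} {j k} → IsMax P j → IsMax P k → j ≡ k
IsMax-unique (pj , j-max) (pk , k-max) = ℕ.≤-antisym (k-max _ pj) (j-max _ pk)

-- Sizes of cubic subtrees

2*≡+ : ∀ m → 2 * m ≡ m + m
2*≡+ m = cong (m +_) (ℕ.+-identityʳ m)

module Cubic {n : ℕ} (G : Graph n) (tree : IsTree G) where

  open Sizes G tree

  DegreeOneOrThree : Fin n → Set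
  DegreeOneOrThree x = degree G x ≡ 1 ⊎ degree G x ≡ 3

  record Leaf (v u : Fin n) : Set where
    field
      adjacent : Adj G v u
      degree≡1 : degree G u ≡ 1
      size≡1   : size v u ≡ 1
      only     : ∀ {x} → Side v u x → x ≡ u

  record Fork (v u w₁ w₂ : Fin n) : Set where
    field
      degree≡3 : degree G u ≡ 3
      isFork   : Children v u (w₁ ∷ w₂ ∷ [])
      size≡    : size v u ≡ suc (size u w₁ + size u w₂)

    open Children isFork public

    adjacent₁ : Adj G u w₁
    adjacent₁ = adjacent (here refl)

    adjacent₂ : Adj G u w₂
    adjacent₂ = adjacent (there (here refl))

    side₁ : ∀ {x} → Side u w₁ x → Side v u x
    side₁ = side-descendant isFork (here refl)

    side₂ : ∀ {x} → Side u w₂ x → Side v u x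
    side₂ = side-descendant isFork (there (here refl))

    split : ∀ {x} → Side v u x → x ≡ u ⊎ Side u w₁ x ⊎ Side u w₂ x
    split {x} s with x Fin.≟ u
    ... | yes x≡u = inj₁ x≡u
    ... | no x≢u with side-child isFork s x≢u
    ...   | _ , here refl , t         = inj₂ (inj₁ t)
    ...   | _ , there (here refl) , t = inj₂ (inj₂ t)

  leaf : ∀ {v u} → Adj G v u → degree G u ≡ 1 → Leaf v u
  leaf {v} {u} e deg≡1 with children (adj-sym G e)
  ... | [] , ch , _ = record
    { adjacent = e
    ; degree≡1 = deg≡1
    ; size≡1   = size-children ch
    ; only     = only
    }
    where
    only : ∀ {x} → Side v u x → x ≡ u
    only {x} s with x Fin.≟ u
    ... | yes x≡u = x≡u
    ... | no x≢u with side-child ch s x≢u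
    ...   | _ , () , _
  ... | _ ∷ _ , _ , len with trans len deg≡1
  ... | ()

  fork : ∀ {v u} → Adj G v u → degree G u ≡ 3 → ∃[ w₁ ] ∃[ w₂ ] Fork v u w₁ w₂
  fork {v} {u} e deg≡3 with children (adj-sym G e)
  ... | ws , ch , len with ws | ch | trans len deg≡3
  ... | w₁ ∷ w₂ ∷ [] | ch′ | _ = w₁ , w₂ , record
    { degree≡3 = deg≡3
    ; isFork   = ch′
    ; size≡    = trans (size-children ch′)
                       (cong (λ s → suc (size u w₁ + s)) (ℕ.+-identityʳ (size u w₂)))
    }

  size-pos : ∀ {v u} → Adj G v u → 1 ≤ size v u
  size-pos {v} {u} e = unique-length-≤ {xs = u ∷ []} ([] ∷ []) (λ { (here refl) → ∈-side⁺ (side-self e) })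

  -- Structural induction on the subtree hanging below `u`. The degree condition is asked only on
  -- that side, so that the scheme also covers the subtrees below the root, of degree 2, of a rooted
  -- binary tree.
  side-rec : (P : Fin n → Fin n → Set) →
             (∀ {v u} → Leaf v u → P v u) →
             (∀ {v u w₁ w₂} → Fork v u w₁ w₂ → P u w₁ → P u w₂ → P v u) →
             ∀ {v u} → Adj G v u → (∀ {x} → Side v u x → DegreeOneOrThree x) → P v u
  side-rec P leaf-case fork-case e deg = go _ e deg ℕ.≤-refl
    where
    go : ∀ N {v u} → Adj G v u → (∀ {x} → Side v u x → DegreeOneOrThree x) →
         size v u ≤ N → P v u
    go zero    e deg ≤N = contradiction (ℕ.≤-trans (size-pos e) ≤N) (λ ())
    go (suc N) {v} {u} e deg ≤N with deg (side-self e)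
    ... | inj₁ deg≡1 = leaf-case (leaf e deg≡1)
    ... | inj₂ deg≡3 with fork e deg≡3
    ... | w₁ , w₂ , f = fork-case f
      (go N (Fork.adjacent₁ f) (deg ∘ Fork.side₁ f) (ℕ.m+n≤o⇒m≤o (size u w₁) sum≤N))
      (go N (Fork.adjacent₂ f) (deg ∘ Fork.side₂ f) (ℕ.m+n≤o⇒n≤o (size u w₁) sum≤N))
      where
      sum≤N : size u w₁ + size u w₂ ≤ N
      sum≤N = ℕ.≤-pred (subst (_≤ suc N) (Fork.size≡ f) ≤N)

  module _ {v u : Fin n} (e : Adj G v u) (deg : ∀ {x} → Side v u x → DegreeOneOrThree x) where

    size-odd : ∃[ j ] size v u ≡ suc (2 * j)
    size-odd = side-rec (λ v u → ∃[ j ] size v u ≡ suc (2 * j))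
      (λ l → 0 , Leaf.size≡1 l)
      (λ { f (i , eq₁) (j , eq₂) → suc (i + j) ,
           trans (Fork.size≡ f) (cong suc (trans (cong₂ _+_ eq₁ eq₂) (double i j))) })
      e deg
      where
      double : ∀ i j → suc (2 * i) + suc (2 * j) ≡ 2 * suc (i + j)
      double i j = begin
        suc (2 * i) + suc (2 * j)  ≡⟨ ℕ.+-suc (suc (2 * i)) (2 * j) ⟩
        2 + (2 * i + 2 * j)        ≡⟨ cong (2 +_) (ℕ.*-distribˡ-+ 2 i j) ⟨
        2 + 2 * (i + j)            ≡⟨ ℕ.*-suc 2 (i + j) ⟨
        2 * suc (i + j)            ∎
        where open ≡-Reasoning

    -- Each vertex on the way from `u` down to `x`, other than `x`, has a second child off that way,
    -- so every level costs at least two vertices.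
    size-deep : ∀ {x} → Side v u x → suc (2 * dist u x) ≤ size v u
    size-deep = side-rec (λ v u → ∀ {x} → Side v u x → suc (2 * dist u x) ≤ size v u)
      (λ {v} {u} l s → ℕ.≤-reflexive (trans
        (cong (λ d → suc (2 * d)) (trans (cong (dist u) (Leaf.only l s)) (dist-refl u)))
        (sym (Leaf.size≡1 l))))
      fork-case e deg
      where
      child : ∀ {u w w′ x} → Adj G u w′ → suc (2 * dist w x) ≤ size u w → Side u w x →
              suc (2 * dist u x) ≤ suc (size u w + size u w′)
      child {u} {w} {w′} {x} e′ ≤s s = s≤s (begin
        2 * dist u x            ≡⟨ cong (2 *_) s ⟨
        2 * suc (dist w x)      ≡⟨ ℕ.*-suc 2 (dist w x) ⟩
        2 + 2 * dist w x        ≡⟨ ℕ.+-comm 1 _ ⟩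
        suc (2 * dist w x) + 1  ≤⟨ ℕ.+-mono-≤ ≤s (size-pos e′) ⟩
        size u w + size u w′    ∎)
        where open ℕ.≤-Reasoning
      fork-case : ∀ {v u w₁ w₂} → Fork v u w₁ w₂ →
        (∀ {x} → Side u w₁ x → suc (2 * dist w₁ x) ≤ size u w₁) →
        (∀ {x} → Side u w₂ x → suc (2 * dist w₂ x) ≤ size u w₂) →
        ∀ {x} → Side v u x → suc (2 * dist u x) ≤ size v u
      fork-case {v} {u} {w₁} {w₂} f rec₁ rec₂ {x} s rewrite Fork.size≡ f with Fork.split f s
      ... | inj₁ refl rewrite dist-refl u = s≤s z≤n
      ... | inj₂ (inj₁ t) = child (Fork.adjacent₂ f) (rec₁ t) t
      ... | inj₂ (inj₂ t) = subst (λ m → suc (2 * dist u x) ≤ suc m) (ℕ.+-comm (size u w₂) (size u w₁))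
                                  (child (Fork.adjacent₁ f) (rec₂ t) t)

    -- If both subtrees at the children had fewer than `2^k` vertices, the whole side would have at
    -- most `2^(k+1) - 1`; so one of them is large enough to descend into.
    deep-vertex : ∀ k → 2 ^ k ≤ size v u → ∃[ x ] Side v u x × k ≤ dist u x
    deep-vertex = side-rec (λ v u → ∀ k → 2 ^ k ≤ size v u → ∃[ x ] Side v u x × k ≤ dist u x)
      (λ { l zero _ → _ , side-self (Leaf.adjacent l) , z≤n
         ; l (suc k) ≤s → contradiction
             (ℕ.≤-trans (ℕ.*-monoʳ-≤ 2 (ℕ.m^n>0 2 k)) (ℕ.≤-trans ≤s (ℕ.≤-reflexive (Leaf.size≡1 l)))) (λ { (s≤s ()) }) })
      fork-case e deg
      where
      fork-case : ∀ {v u w₁ w₂} → Fork v u w₁ w₂ →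
        (∀ k → 2 ^ k ≤ size u w₁ → ∃[ x ] Side u w₁ x × k ≤ dist w₁ x) →
        (∀ k → 2 ^ k ≤ size u w₂ → ∃[ x ] Side u w₂ x × k ≤ dist w₂ x) →
        ∀ k → 2 ^ k ≤ size v u → ∃[ x ] Side v u x × k ≤ dist u x
      fork-case f _ _ zero _ = _ , side-self (adj-sym G (Fork.parent f)) , z≤n
      fork-case {v} {u} {w₁} {w₂} f rec₁ rec₂ (suc k) ≤s with 2 ^ k ℕ.≤? size u w₁ | 2 ^ k ℕ.≤? size u w₂
      ... | yes ≤s₁ | _ with rec₁ k ≤s₁
      ...   | x , s , ≤d = x , Fork.side₁ f s , ℕ.≤-trans (s≤s ≤d) (ℕ.≤-reflexive s)
      fork-case {v} {u} {w₁} {w₂} f rec₁ rec₂ (suc k) ≤s | no _ | yes ≤s₂ with rec₂ k ≤s₂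
      ...   | x , s , ≤d = x , Fork.side₂ f s , ℕ.≤-trans (s≤s ≤d) (ℕ.≤-reflexive s)
      fork-case {v} {u} {w₁} {w₂} f rec₁ rec₂ (suc k) ≤s | no ≰s₁ | no ≰s₂ = contradiction (begin-strict
        suc (size u w₁ + size u w₂)        <⟨ ℕ.≤-reflexive (cong suc (sym (ℕ.+-suc (size u w₁) (size u w₂)))) ⟩
        suc (size u w₁) + suc (size u w₂)  ≤⟨ ℕ.+-mono-≤ (ℕ.≰⇒> ≰s₁) (ℕ.≰⇒> ≰s₂) ⟩
        2 ^ k + 2 ^ k                      ≡⟨ 2*≡+ (2 ^ k) ⟨
        2 ^ suc k                          ≤⟨ ≤s ⟩
        size v u                           ≡⟨ Fork.size≡ f ⟩
        suc (size u w₁ + size u w₂)        ∎) (ℕ.<-irrefl refl)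
        where open ℕ.≤-Reasoning

    -- Without leaves above level `k`, the levels 0 to `k` are complete and contain `2^(k+1) - 1`
    -- vertices; a vertex below level `k` is one more. The induction needs both counts, since a deep
    -- vertex lies under only one of the two children.
    size-full : ∀ k → (∀ {x} → Side v u x → degree G x ≡ 1 → k ≤ dist u x) →
                2 ^ suc k ≤ suc (size v u) ×
                (∀ {x} → Side v u x → k < dist u x → 2 ^ suc k ≤ size v u)
    size-full = side-rec Full leaf-case fork-case e deg
      where
      Full : Fin n → Fin n → Set
      Full v u = ∀ k → (∀ {x} → Side v u x → degree G x ≡ 1 → k ≤ dist u x) →
                 2 ^ suc k ≤ suc (size v u) ×
                 (∀ {x} → Side v u x → k < dist u x → 2 ^ suc k ≤ size v u)
      leaf-case : ∀ {v u} → Leaf v u → Full v u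
      leaf-case {v} {u} l k leaves with ℕ.≤-trans (leaves (side-self (Leaf.adjacent l)) (Leaf.degree≡1 l)) (ℕ.≤-reflexive (dist-refl u))
      ... | z≤n = ℕ.≤-reflexive (cong suc (sym (Leaf.size≡1 l))) ,
        λ s k< → contradiction (ℕ.≤-trans k< (ℕ.≤-reflexive (trans (cong (dist u) (Leaf.only l s)) (dist-refl u)))) (λ ())
      fork-case : ∀ {v u w₁ w₂} → Fork v u w₁ w₂ → Full u w₁ → Full u w₂ → Full v u
      fork-case f _ _ zero _ rewrite Fork.size≡ f =
        s≤s (s≤s z≤n) , λ _ _ → s≤s (ℕ.≤-trans (size-pos (Fork.adjacent₁ f)) (ℕ.m≤m+n _ _))
      fork-case {v} {u} {w₁} {w₂} f rec₁ rec₂ (suc k) leaves =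
        subst (λ s → 2 ^ suc (suc k) ≤ suc s) (sym (Fork.size≡ f)) (begin
          2 ^ suc (suc k)                          ≡⟨ 2*≡+ (2 ^ suc k) ⟩
          2 ^ suc k + 2 ^ suc k                    ≤⟨ ℕ.+-mono-≤ (proj₁ full₁) (proj₁ full₂) ⟩
          suc (size u w₁) + suc (size u w₂)        ≡⟨ ℕ.+-suc (suc (size u w₁)) (size u w₂) ⟩
          suc (suc (size u w₁ + size u w₂))        ∎) ,
        λ s k< → subst (2 ^ suc (suc k) ≤_) (sym (Fork.size≡ f)) (beyond s k<)
        where
        open ℕ.≤-Reasoning
        full₁ : 2 ^ suc k ≤ suc (size u w₁) × (∀ {x} → Side u w₁ x → k < dist w₁ x → 2 ^ suc k ≤ size u w₁)
        full₁ = rec₁ k (λ s l → ℕ.≤-pred (ℕ.≤-trans (leaves (Fork.side₁ f s) l) (ℕ.≤-reflexive (sym s))))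
        full₂ : 2 ^ suc k ≤ suc (size u w₂) × (∀ {x} → Side u w₂ x → k < dist w₂ x → 2 ^ suc k ≤ size u w₂)
        full₂ = rec₂ k (λ s l → ℕ.≤-pred (ℕ.≤-trans (leaves (Fork.side₂ f s) l) (ℕ.≤-reflexive (sym s))))
        beyond : ∀ {x} → Side v u x → suc k < dist u x → 2 ^ suc (suc k) ≤ suc (size u w₁ + size u w₂)
        beyond s k< with Fork.split f s
        ... | inj₁ refl = contradiction (ℕ.≤-trans k< (ℕ.≤-reflexive (dist-refl u))) (λ ())
        ... | inj₂ (inj₁ t) = begin
          2 ^ suc (suc k)               ≡⟨ 2*≡+ (2 ^ suc k) ⟩
          2 ^ suc k + 2 ^ suc k         ≤⟨ ℕ.+-mono-≤ (proj₂ full₁ t (ℕ.≤-pred (ℕ.≤-trans k< (ℕ.≤-reflexive (sym t))))) (proj₁ full₂) ⟩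
          size u w₁ + suc (size u w₂)   ≡⟨ ℕ.+-suc (size u w₁) (size u w₂) ⟩
          suc (size u w₁ + size u w₂)   ∎
        ... | inj₂ (inj₂ t) = begin
          2 ^ suc (suc k)               ≡⟨ 2*≡+ (2 ^ suc k) ⟩
          2 ^ suc k + 2 ^ suc k         ≤⟨ ℕ.+-mono-≤ (proj₁ full₁) (proj₂ full₂ t (ℕ.≤-pred (ℕ.≤-trans k< (ℕ.≤-reflexive (sym t))))) ⟩
          suc (size u w₁) + size u w₂   ∎

    -- In a caterpillar one of the children of a non-leaf is a leaf, so that
    -- descending one level discards only two vertices.
    size-narrow : (∀ {m w₁ w₂ w₃} → Adj G m w₁ → Adj G m w₂ → Adj G m w₃ →
                   w₁ ≢ w₂ → w₁ ≢ w₃ → w₂ ≢ w₃ →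
                   degree G w₁ ≡ 1 ⊎ degree G w₂ ≡ 1 ⊎ degree G w₃ ≡ 1) →
                  degree G v ≢ 1 → ∃[ x ] Side v u x × size v u ≤ suc (2 * dist u x)
    size-narrow narrow = side-rec Narrow
      (λ l _ → _ , side-self (Leaf.adjacent l) , ℕ.≤-trans (ℕ.≤-reflexive (Leaf.size≡1 l)) (s≤s z≤n))
      fork-case e deg
      where
      Narrow : Fin n → Fin n → Set
      Narrow v u = degree G v ≢ 1 → ∃[ x ] Side v u x × size v u ≤ suc (2 * dist u x)
      child : ∀ {u w w′ x} → Leaf u w′ → Side u w x → size u w ≤ suc (2 * dist w x) →
              suc (size u w + size u w′) ≤ suc (2 * dist u x)
      child {u} {w} {w′} {x} l s ≤d = s≤s (begin
        size u w + size u w′    ≤⟨ ℕ.+-mono-≤ ≤d (ℕ.≤-reflexive (Leaf.size≡1 l)) ⟩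
        suc (2 * dist w x) + 1  ≡⟨ ℕ.+-comm 1 _ ⟨
        2 + 2 * dist w x        ≡⟨ ℕ.*-suc 2 (dist w x) ⟨
        2 * suc (dist w x)      ≡⟨ cong (2 *_) s ⟩
        2 * dist u x            ∎)
        where open ℕ.≤-Reasoning
      fork-case : ∀ {v u w₁ w₂} → Fork v u w₁ w₂ → Narrow u w₁ → Narrow u w₂ → Narrow v u
      fork-case {v} {u} {w₁} {w₂} f rec₁ rec₂ v≢1
        with narrow (Fork.parent f) (Fork.adjacent₁ f) (Fork.adjacent₂ f)
               (Fork.not-parent f (here refl)) (Fork.not-parent f (there (here refl)))
               (All.head (AllPairs.head (AllPairs.tail (Fork.unique f))))
      ... | inj₁ v≡1 = contradiction v≡1 v≢1
      ... | inj₂ (inj₁ w₁≡1) with rec₂ (λ u≡1 → contradiction (trans (sym (Fork.degree≡3 f)) u≡1) (λ ()))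
      ...   | x , s , ≤d = x , Fork.side₂ f s , subst (_≤ suc (2 * dist u x))
              (sym (trans (Fork.size≡ f) (cong suc (ℕ.+-comm (size u w₁) (size u w₂)))))
              (child (leaf (Fork.adjacent₁ f) w₁≡1) s ≤d)
      fork-case {v} {u} {w₁} {w₂} f rec₁ rec₂ v≢1 | inj₂ (inj₂ w₂≡1) with rec₁ (λ u≡1 → contradiction (trans (sym (Fork.degree≡3 f)) u≡1) (λ ()))
      ...   | x , s , ≤d = x , Fork.side₁ f s , subst (_≤ suc (2 * dist u x))
              (sym (Fork.size≡ f)) (child (leaf (Fork.adjacent₂ f) w₂≡1) s ≤d)

-- Center and centroid

module _ {A : Set} {R : A → ℕ → Set} (f : A → ℕ)
         (value : ∀ x → R x (f x)) (functional : ∀ {x k} → R x k → f x ≡ k) where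

  minimizer⁺ : ∀ {x} → (∀ y → f x ≤ f y) → Minimizer R x
  minimizer⁺ {x} x-min = f x , value x , λ y j r → ℕ.≤-trans (x-min y) (ℕ.≤-reflexive (functional r))

  minimizer⁻ : ∀ {x} → Minimizer R x → ∀ y → f x ≤ f y
  minimizer⁻ {x} (k , r , k-min) y = ℕ.≤-trans (ℕ.≤-reflexive (functional r)) (k-min y (f y) (value y))

  maximizer⁻ : ∀ {x} → Maximizer R x → ∀ y → f y ≤ f x
  maximizer⁻ {x} (k , r , k-max) y = ℕ.≤-trans (k-max y (f y) (value y)) (ℕ.≤-reflexive (sym (functional r)))

module Extremes {n : ℕ} (G : Graph n) (tree : IsTree G)
                (x₀ : Fin n) (neighbour : ∀ v → ∃ (Adj G v)) where

  open Weights G tree public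

  farthest : ∀ v → ∃[ x ] ∀ y → dist v y ≤ dist v x
  farthest v = argmax (dist v) x₀

  far : Fin n → Fin n
  far v = proj₁ (farthest v)

  ecc : Fin n → ℕ
  ecc v = dist v (far v)

  dist≤ecc : ∀ v y → dist v y ≤ ecc v
  dist≤ecc v = proj₂ (farthest v)

  ecc-isEccentricity : ∀ v → IsEccentricity G v (ecc v)
  ecc-isEccentricity v =
    (far v , subst (IsDist G (far v) v) (dist-sym (far v) v) (dist-isDist (far v) v)) ,
    λ { k (y , d) → ℕ.≤-trans (ℕ.≤-reflexive (trans (sym (isDist⇒≡ d)) (dist-sym y v))) (dist≤ecc v y) }

  ecc-functional : ∀ {v k} → IsEccentricity G v k → ecc v ≡ k
  ecc-functional = IsMax-unique (ecc-isEccentricity _)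

  heaviest : ∀ v → ∃ (IsMax (HasSide v))
  heaviest v = greatest (λ k → Fin.any? λ u → adj? v u ×-dec size v u ℕ.≟ k) n
    (λ { k (u , _ , refl) → size-≤ v u }) {size v (proj₁ (neighbour v))} (_ , proj₂ (neighbour v) , refl)

  weight : Fin n → ℕ
  weight v = proj₁ (heaviest v)

  weight-attained : ∀ v → HasSide v (weight v)
  weight-attained v = proj₁ (proj₂ (heaviest v))

  size≤weight : ∀ {v u} → Adj G v u → size v u ≤ weight v
  size≤weight {v} e = proj₂ (proj₂ (heaviest v)) _ (_ , e , refl)

  weight-isWeight : ∀ v → IsWeight G v (weight v)
  weight-isWeight v = hasSide⇒weight (proj₂ (heaviest v))

  weight-functional : ∀ {v k} → IsWeight G v k → weight v ≡ k
  weight-functional = IsMax-unique (weight-isWeight _)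

  MinimalFor : (Fin n → ℕ) → Fin n → Set
  MinimalFor f x = ∀ y → f x ≤ f y

  minimalFor? : ∀ f → Decidable (MinimalFor f)
  minimalFor? f x = Fin.all? (λ y → f x ℕ.≤? f y)

  not-minimal : ∀ f {x y} → MinimalFor f x → ¬ MinimalFor f y → f x < f y
  not-minimal f {x} {y} x-min ¬y-min with f x ℕ.<? f y
  ... | yes x<y = x<y
  ... | no  x≮y = contradiction (λ z → ℕ.≤-trans (ℕ.≮⇒≥ x≮y) (x-min z)) ¬y-min

  center⁺ : ∀ {x} → MinimalFor ecc x → Center G x
  center⁺ = minimizer⁺ ecc ecc-isEccentricity ecc-functional

  center⁻ : ∀ {x} → Center G x → MinimalFor ecc x
  center⁻ = minimizer⁻ ecc ecc-isEccentricity ecc-functional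

  centroid⁺ : ∀ {x} → MinimalFor weight x → Centroid G x
  centroid⁺ = minimizer⁺ weight weight-isWeight weight-functional

  centroid⁻ : ∀ {x} → Centroid G x → MinimalFor weight x
  centroid⁻ = minimizer⁻ weight weight-isWeight weight-functional

  record Nearest (z c : Fin n) : Set where
    field
      center   : MinimalFor ecc z
      centroid : MinimalFor weight c
      nearest  : ∀ {z′ c′} → MinimalFor ecc z′ → MinimalFor weight c′ → dist z c ≤ dist z′ c′

    isSetDist : IsSetDist G (Center G) (Centroid G) (dist z c)
    isSetDist = (z , c , center⁺ center , centroid⁺ centroid , dist-isDist z c) ,
      λ { k (z′ , c′ , z′∈ , c′∈ , d) → ℕ.≤-trans (nearest (center⁻ z′∈) (centroid⁻ c′∈)) (ℕ.≤-reflexive (isDist⇒≡ d)) }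

  nearest-pair : ∃[ z ] ∃[ c ] Nearest z c
  nearest-pair with argmin ecc x₀ | argmin weight x₀
  ... | z₀ , z₀-min | c₀ , c₀-min
    with least (λ k → Fin.any? λ z → Fin.any? λ c →
                 minimalFor? ecc z ×-dec minimalFor? weight c ×-dec dist z c ℕ.≟ k)
               (z₀ , c₀ , z₀-min , c₀-min , refl)
  ... | _ , (z , c , z-min , c-min , refl) , d-min = z , c , record
    { center   = z-min
    ; centroid = c-min
    ; nearest  = λ z′-min c′-min → d-min _ (_ , _ , z′-min , c′-min , refl)
    }

  -- The heaviest branch at `c′` must be the one toward `c`: any other lies properly inside the
  -- branch at `c` toward `c′`, whose size is at most the weight of `c`.
  weight-<⇒size-< : ∀ {c c′} → Adj G c c′ → weight c < weight c′ → size c c′ < size c′ c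
  weight-<⇒size-< {c} {c′} e c<c′ with weight-attained c′
  ... | u , f , eq with c Fin.≟ u
  ... | yes refl = ℕ.<-≤-trans (ℕ.≤-<-trans (size≤weight e) c<c′) (ℕ.≤-reflexive (sym eq))
  ... | no c≢u = contradiction (begin-strict
      size c′ u  <⟨ size-mono (adj-sym G e) f c≢u ⟩
      size c c′  ≤⟨ size≤weight e ⟩
      weight c   <⟨ c<c′ ⟩
      weight c′  ≡⟨ eq ⟨
      size c′ u  ∎) (ℕ.<-irrefl refl)
    where open ℕ.≤-Reasoning

  size-<⇒weight-< : ∀ {c c′} → Adj G c c′ → size c′ c < size c c′ → weight c′ < weight c
  size-<⇒weight-< {c} {c′} e c′<c with weight-attained c′
  ... | u , f , eq with c Fin.≟ u
  ... | yes refl = ℕ.≤-<-trans (ℕ.≤-reflexive (sym eq)) (ℕ.<-≤-trans c′<c (size≤weight e))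
  ... | no c≢u = ℕ.≤-<-trans (ℕ.≤-reflexive (sym eq)) (ℕ.<-≤-trans (size-mono (adj-sym G e) f c≢u) (size≤weight e))

  module _ {z c : Fin n} (nearest : Nearest z c) (z≢c : z ≢ c) where
    open Nearest nearest using (center; centroid) renaming (nearest to minimal)

    -- The witness `w` is a vertex farthest from `z′`, the neighbour of `z` toward `c`. As
    -- `ecc z < ecc z′`, it satisfies `dist z w ≥ ecc z ≥ dist z x = D + dist c x` with `D = dist z
    -- c`. The way from `c` to `w` leads through `z` and contributes the second `D`.
    opposite-depth : ∃[ c′ ] Adj G c c′ × size c c′ < size c′ c ×
      (∀ {x} → Side c′ c x → ∃[ w ] Side c c′ w × 2 * dist z c + dist c x ≤ dist c w)
    opposite-depth with next (z≢c ∘ sym) | next z≢c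
    ... | c′ , e , c′-closer | z′ , f , z′-closer =
      c′ , e , weight-<⇒size-< e (not-minimal weight centroid c′-not-centroid) , reach
      where
      open ℕ.≤-Reasoning
      c′-not-centroid : ¬ MinimalFor weight c′
      c′-not-centroid c′-min = ℕ.<-irrefl refl (begin-strict
        dist z c   ≤⟨ minimal center c′-min ⟩
        dist z c′  ≡⟨ dist-sym z c′ ⟩
        dist c′ z  <⟨ ℕ.≤-reflexive c′-closer ⟩
        dist c z   ≡⟨ dist-sym c z ⟩
        dist z c   ∎)
      z′-not-center : ¬ MinimalFor ecc z′
      z′-not-center z′-min = ℕ.<-irrefl refl (begin-strict
        dist z c   ≤⟨ minimal z′-min centroid ⟩
        dist z′ c  <⟨ ℕ.≤-reflexive z′-closer ⟩
        dist z c   ∎)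
      ecc-< : ecc z < ecc z′
      ecc-< = not-minimal ecc center z′-not-center
      w : Fin n
      w = far z′
      reach : ∀ {x} → Side c′ c x → ∃[ w ] Side c c′ w × 2 * dist z c + dist c x ≤ dist c w
      reach {x} s = w , ℕ.≤-antisym side-w (dist-adj e w) , (begin
        2 * dist z c + dist c x           ≡⟨ cong (_+ dist c x) (2*≡+ (dist z c)) ⟩
        (dist z c + dist z c) + dist c x  ≡⟨ ℕ.+-assoc (dist z c) (dist z c) (dist c x) ⟩
        dist z c + (dist z c + dist c x)  ≡⟨ cong (dist z c +_) zx ⟨
        dist z c + dist z x               ≤⟨ ℕ.+-monoʳ-≤ (dist z c) (ℕ.≤-trans (dist≤ecc z x) (ℕ.≤-pred (ℕ.≤-trans ecc-< (dist-adj (adj-sym G f) w)))) ⟩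
        dist z c + dist z w               ≡⟨ cong (_+ dist z w) (dist-sym z c) ⟩
        dist c z + dist z w               ≡⟨ cw ⟨
        dist c w                          ∎)
        where
        zx : dist z x ≡ dist z c + dist c x
        zx = dist-through λ g t t′ → side-asym (subst (λ u → Side c u x) (side-unique g e t c′-closer) t′) s
        -- Were `w` on the `z′`-side of `z`, then `ecc z′ = dist z′ w < dist z w ≤ ecc z`.
        cw : dist c w ≡ dist c z + dist z w
        cw = dist-through λ g t t′ → ℕ.<-asym ecc-<
          (ℕ.<-≤-trans (ℕ.≤-reflexive (subst (λ u → Side z u w) (side-unique g f t z′-closer) t′)) (dist≤ecc z w))
        side-w : suc (dist c′ w) ≤ dist c w
        side-w = begin
          suc (dist c′ w)              ≤⟨ s≤s (dist-triangle c′ z w) ⟩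
          suc (dist c′ z) + dist z w   ≡⟨ cong (_+ dist z w) c′-closer ⟩
          dist c z + dist z w          ≡⟨ cw ⟨
          dist c w                     ∎

    module _ (cubic : ∀ v → degree G v ≡ 1 ⊎ degree G v ≡ 3) where

      open Cubic G tree

      degrees : ∀ {v u x} → Side v u x → DegreeOneOrThree x
      degrees {x = x} _ = cubic x

      -- The sizes of the two sides of `cc′` are `2b+1` at `c′` and `2a+1` at `c`. Only these
      -- numbers leave the tree, so the rest of the upper bound is arithmetic.
      nearest-bound : ∃[ a ] ∃[ b ] n ≡ suc (2 * b) + suc (2 * a) × b < a ×
                      (∀ k → 2 ^ k ≤ suc (2 * a) → 2 * dist z c + k ≤ suc b)
      nearest-bound with opposite-depth
      ... | c′ , e , light , reach with size-odd e degrees | size-odd (adj-sym G e) degrees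
      ... | b , size-b | a , size-a = a , b , trans (size-complement e) (cong₂ _+_ size-b size-a)
        , ℕ.*-cancelˡ-< 2 b a (ℕ.≤-pred (subst₂ _<_ size-b size-a light)) , bound
        where
        open ℕ.≤-Reasoning
        bound : ∀ k → 2 ^ k ≤ suc (2 * a) → 2 * dist z c + k ≤ suc b
        bound k ≤a with deep-vertex (adj-sym G e) degrees k (ℕ.≤-trans ≤a (ℕ.≤-reflexive (sym size-a)))
        ... | x , s , k≤d with reach s
        ... | w , t , ≤dw = begin
          2 * dist z c + k         ≤⟨ ℕ.+-monoʳ-≤ (2 * dist z c) k≤d ⟩
          2 * dist z c + dist c x  ≤⟨ ≤dw ⟩
          dist c w                 ≡⟨ t ⟨
          suc (dist c′ w)          ≤⟨ s≤s (ℕ.*-cancelˡ-≤ 2 (ℕ.≤-pred (ℕ.≤-trans (size-deep e degrees t) (ℕ.≤-reflexive size-b)))) ⟩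
          suc b                    ∎

-- Caterpillars and rgood trees

linked-++⁻ˡ : ∀ {A : Set} {R : A → A → Set} xs {ys} → Linked R (xs ++ ys) → Linked R xs
linked-++⁻ˡ []           _       = []
linked-++⁻ˡ (x ∷ [])     _       = [-]
linked-++⁻ˡ (x ∷ y ∷ xs) (r ∷ l) = r ∷ linked-++⁻ˡ (y ∷ xs) l

linked-++⁻ʳ : ∀ {A : Set} {R : A → A → Set} xs {ys} → Linked R (xs ++ ys) → Linked R ys
linked-++⁻ʳ []       l = l
linked-++⁻ʳ (x ∷ xs) l = linked-++⁻ʳ xs (Linked.tail l)

unique-++⁻ : ∀ {A : Set} {m : A} xs {ys} → Unique (xs ++ m ∷ ys) → All (m ≢_) xs × All (m ≢_) ys
unique-++⁻ []       (m∉ys ∷ _)     = [] , m∉ys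
unique-++⁻ (x ∷ xs) (x∉ ∷ xsmys!) with unique-++⁻ xs xsmys!
... | m∉xs , m∉ys = (All.lookup x∉ (∈-++⁺ʳ xs (here refl)) ∘ sym) ∷ m∉xs , m∉ys

another : ∀ {n} → 2 ≤ n → (v : Fin n) → ∃ (v ≢_)
another (s≤s (s≤s z≤n)) zero    = suc zero , λ ()
another (s≤s (s≤s z≤n)) (suc v) = zero , λ ()

binary⇒cubic : ∀ {n} {G : Graph n} → IsBinaryTree G → ∀ v → degree G v ≡ 1 ⊎ degree G v ≡ 3
binary⇒cubic {G = G} (_ , deg) v with degree G v ℕ.≟ 1
... | yes deg≡1 = inj₁ deg≡1
... | no  deg≢1 = inj₂ (deg v deg≢1)

module Caterpillar {n : ℕ} (G : Graph n) (caterpillar : IsBinaryCaterpillar G) where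

  tree : IsTree G
  tree = proj₁ (proj₁ caterpillar)

  cubic : ∀ v → degree G v ≡ 1 ⊎ degree G v ≡ 3
  cubic = binary⇒cubic (proj₁ caterpillar)

  open Sizes G tree
  open Cubic G tree

  spine : List (Fin n)
  spine = proj₁ (proj₂ caterpillar)

  spine! : Unique spine
  spine! = proj₁ (proj₁ (proj₂ (proj₂ caterpillar)))

  spine-linked : Linked (Adj G) spine
  spine-linked = proj₂ (proj₁ (proj₂ (proj₂ caterpillar)))

  module _ {v u : Fin n} (e : Adj G v u) where

    side-onwards : ∀ {x xs} → Linked (Adj G) (x ∷ xs) → All (v ≢_) (x ∷ xs) →
                   Side v u x → All (Side v u) (x ∷ xs)
    side-onwards [-]     _          s = s ∷ []
    side-onwards (f ∷ l) (_ ∷ v∉@(v≢y ∷ _)) s = s ∷ side-onwards l v∉ (side-adj e s f v≢y)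

    side-throughout : ∀ {xs a} → Linked (Adj G) xs → All (v ≢_) xs →
                      a ∈ˡ xs → Side v u a → All (Side v u) xs
    side-throughout l       v∉       (here refl) s = side-onwards l v∉ s
    side-throughout [-]     _        (there ())  _
    side-throughout (f ∷ l) (v≢x ∷ v∉) (there a∈)  s with side-throughout l v∉ a∈ s
    ... | sy ∷ ss = side-adj e sy (adj-sym G f) v≢x ∷ sy ∷ ss

  -- If `v` is off the spine, the whole spine lies on the side of one neighbour `u`. A second
  -- neighbour `x` of `v` is on the spine or adjacent to it, hence on the same side, which forces
  -- `x = u`.
  nonleaf∈spine : ∀ {v} → degree G v ≢ 1 → v ∈ˡ spine
  nonleaf∈spine {v} v≢1 with any? (v Fin.≟_) spine
  ... | yes v∈ = v∈
  ... | no v∉ with proj₂ (proj₂ (proj₂ caterpillar)) v v∉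
  ... | u , u∈ , e with fork (adj-sym G e) (proj₂ (proj₁ caterpillar) v v≢1)
  ... | x , _ , f = contradiction x-side u≁x
    where
    spine-side : All (Side v u) spine
    spine-side = side-throughout e spine-linked (All.¬Any⇒All¬ _ v∉) u∈ (side-self e)
    vx : Adj G v x
    vx = Fork.adjacent₁ f
    u≁x : ¬ Side v u x
    u≁x s = Fork.not-parent f (here refl) (side-unique e vx s (side-self vx))
    x-side : Side v u x
    x-side with any? (x Fin.≟_) spine
    ... | yes x∈ = All.lookup spine-side x∈
    ... | no x∉ with proj₂ (proj₂ (proj₂ caterpillar)) x x∉
    ... | u′ , u′∈ , g = side-adj e (All.lookup spine-side u′∈) (adj-sym G g) (adj⇒≢ {G = G} vx)

  -- Deleting m cuts the spine into two pieces, each on one side of m, so two of three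
  -- neighbours of m on the spine would lie on the same side.
  narrow : ∀ {m w₁ w₂ w₃} → Adj G m w₁ → Adj G m w₂ → Adj G m w₃ →
           w₁ ≢ w₂ → w₁ ≢ w₃ → w₂ ≢ w₃ →
           degree G w₁ ≡ 1 ⊎ degree G w₂ ≡ 1 ⊎ degree G w₃ ≡ 1
  narrow {m} {w₁} {w₂} {w₃} e₁ e₂ e₃ w₁≢w₂ w₁≢w₃ w₂≢w₃
    with degree G w₁ ℕ.≟ 1 | degree G w₂ ℕ.≟ 1 | degree G w₃ ℕ.≟ 1
  ... | yes w₁≡1 | _ | _ = inj₁ w₁≡1
  ... | no _ | yes w₂≡1 | _ = inj₂ (inj₁ w₂≡1)
  ... | no _ | no _ | yes w₃≡1 = inj₂ (inj₂ w₃≡1)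
  ... | no w₁≢1 | no w₂≢1 | no w₃≢1
    with ∈-∃++ (nonleaf∈spine {m} (λ m≡1 → w₁≢w₂ (∣S∣≡1⇒≡ m≡1 e₁ e₂)))
  ... | as , bs , spine≡ = ⊥-elim (pigeons (place e₁ w₁≢1) (place e₂ w₂≢1) (place e₃ w₃≢1))
    where
    m∉ : All (m ≢_) as × All (m ≢_) bs
    m∉ = unique-++⁻ as (subst Unique spine≡ spine!)
    linked : Linked (Adj G) (as ++ m ∷ bs)
    linked = subst (Linked (Adj G)) spine≡ spine-linked
    place : ∀ {w} → Adj G m w → degree G w ≢ 1 → w ∈ˡ as ⊎ w ∈ˡ bs
    place {w} e w≢1 with ∈-++⁻ as (subst (w ∈ˡ_) spine≡ (nonleaf∈spine w≢1))
    ... | inj₁ w∈          = inj₁ w∈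
    ... | inj₂ (here refl) = contradiction e (irrefl G)
    ... | inj₂ (there w∈)  = inj₂ w∈
    clash : ∀ {xs w w′} → Linked (Adj G) xs → All (m ≢_) xs → Adj G m w → Adj G m w′ →
            w ≢ w′ → w ∈ˡ xs → w′ ∈ˡ xs → ⊥
    clash l m∉xs e e′ w≢w′ w∈ w′∈ = w≢w′ (side-unique e e′
      (All.lookup (side-throughout e l m∉xs w∈ (side-self e)) w′∈) (side-self e′))
    clash-as : ∀ {w w′} → Adj G m w → Adj G m w′ → w ≢ w′ → w ∈ˡ as → w′ ∈ˡ as → ⊥
    clash-as = clash (linked-++⁻ˡ as linked) (proj₁ m∉)
    clash-bs : ∀ {w w′} → Adj G m w → Adj G m w′ → w ≢ w′ → w ∈ˡ bs → w′ ∈ˡ bs → ⊥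
    clash-bs = clash (Linked.tail (linked-++⁻ʳ as linked)) (proj₂ m∉)
    pigeons : w₁ ∈ˡ as ⊎ w₁ ∈ˡ bs → w₂ ∈ˡ as ⊎ w₂ ∈ˡ bs → w₃ ∈ˡ as ⊎ w₃ ∈ˡ bs → ⊥
    pigeons (inj₁ i) (inj₁ j) _        = clash-as e₁ e₂ w₁≢w₂ i j
    pigeons (inj₁ i) (inj₂ j) (inj₁ k) = clash-as e₁ e₃ w₁≢w₃ i k
    pigeons (inj₁ i) (inj₂ j) (inj₂ k) = clash-bs e₂ e₃ w₂≢w₃ j k
    pigeons (inj₂ i) (inj₂ j) _        = clash-bs e₁ e₂ w₁≢w₂ i j
    pigeons (inj₂ i) (inj₁ j) (inj₁ k) = clash-as e₂ e₃ w₂≢w₃ j k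
    pigeons (inj₂ i) (inj₁ j) (inj₂ k) = clash-bs e₁ e₃ w₁≢w₃ i k

  -- Descending into both other branches at `m` by `size-narrow` gives depths `d₁`, `d₂` below `w₁`,
  -- `w₂` with sizes at most `2d₁+1` and `2d₂+1`. Adding `m` and its leaf `v`, `n` is at most
  -- `2(d₁+1) + 2(d₂+1)`, twice the distance of the two vertices found.
  long-through-leaf : ∀ {v m} → Adj G v m → degree G v ≡ 1 → degree G m ≡ 3 →
                      ∃[ x ] ∃[ y ] n ≤ 2 * dist x y
  long-through-leaf {v} {m} e v≡1 m≡3 with fork e m≡3
  ... | w₁ , w₂ , f with size-narrow (Fork.adjacent₁ f) (λ {x} _ → cubic x) narrow m≢1
                       | size-narrow (Fork.adjacent₂ f) (λ {x} _ → cubic x) narrow m≢1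
    where
    m≢1 : degree G m ≢ 1
    m≢1 m≡1 = contradiction (trans (sym m≡3) m≡1) (λ ())
  ... | x , s , ≤x | y , t , ≤y = x , y , (begin
    n                                              ≡⟨ size-complement e ⟩
    size v m + size m v                            ≡⟨ cong₂ _+_ (Fork.size≡ f) (Leaf.size≡1 (leaf (adj-sym G e) v≡1)) ⟩
    suc (size m w₁ + size m w₂) + 1                ≡⟨ ℕ.+-comm _ 1 ⟩
    2 + (size m w₁ + size m w₂)                    ≤⟨ ℕ.+-monoʳ-≤ 2 (ℕ.+-mono-≤ ≤x ≤y) ⟩
    2 + (suc (2 * dist w₁ x) + suc (2 * dist w₂ y)) ≡⟨ ℕ.+-suc (2 + 2 * dist w₁ x) (suc (2 * dist w₂ y)) ⟨
    2 + 2 * dist w₁ x + (2 + 2 * dist w₂ y)        ≡⟨ cong₂ _+_ (ℕ.*-suc 2 (dist w₁ x)) (ℕ.*-suc 2 (dist w₂ y)) ⟨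
    2 * suc (dist w₁ x) + 2 * suc (dist w₂ y)      ≡⟨ ℕ.*-distribˡ-+ 2 (suc (dist w₁ x)) (suc (dist w₂ y)) ⟨
    2 * (suc (dist w₁ x) + suc (dist w₂ y))        ≡⟨ cong (2 *_) (cong₂ _+_ (trans s (dist-sym m x)) t) ⟩
    2 * (dist x m + dist m y)                      ≡⟨ cong (2 *_) (dist-through apart) ⟨
    2 * dist x y                                   ∎)
    where
    open ℕ.≤-Reasoning
    apart : ∀ {w} → Adj G m w → Side m w x → ¬ Side m w y
    apart g s′ t′ = All.head (AllPairs.head (AllPairs.tail (Fork.unique f)))
      (trans (side-unique (Fork.adjacent₁ f) g s s′) (side-unique g (Fork.adjacent₂ f) t′ t))

  long-through : ∀ {m} → degree G m ≡ 3 → ∃ (Adj G m) → ∃[ x ] ∃[ y ] n ≤ 2 * dist x y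
  long-through {m} m≡3 (v , e) with fork (adj-sym G e) m≡3
  ... | w₁ , w₂ , f with narrow (Fork.parent f) (Fork.adjacent₁ f) (Fork.adjacent₂ f)
               (Fork.not-parent f (here refl)) (Fork.not-parent f (there (here refl)))
               (All.head (AllPairs.head (AllPairs.tail (Fork.unique f))))
  ... | inj₁ v≡1         = long-through-leaf (adj-sym G e) v≡1 m≡3
  ... | inj₂ (inj₁ w₁≡1) = long-through-leaf (adj-sym G (Fork.adjacent₁ f)) w₁≡1 m≡3
  ... | inj₂ (inj₂ w₂≡1) = long-through-leaf (adj-sym G (Fork.adjacent₂ f)) w₂≡1 m≡3

  -- Two adjacent leaves would form the whole tree, so `v` or its neighbour has degree 3.
  long : 3 ≤ n → Fin n → ∃[ x ] ∃[ y ] n ≤ 2 * dist x y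
  long 3≤n v with next (proj₂ (another (ℕ.<⇒≤ 3≤n) v))
  ... | u , e , _ with cubic v | cubic u
  ... | inj₂ v≡3 | _        = long-through v≡3 (u , e)
  ... | inj₁ _   | inj₂ u≡3 = long-through u≡3 (v , adj-sym G e)
  ... | inj₁ v≡1 | inj₁ u≡1 = contradiction
    (trans (size-complement e) (cong₂ _+_ (Leaf.size≡1 (leaf e u≡1)) (Leaf.size≡1 (leaf (adj-sym G e) v≡1))))
    (ℕ.>⇒≢ 3≤n)

module Rgood {l : ℕ} (R : Graph l) (root : Fin l) (rgood : IsRgood R root) (3≤l : 3 ≤ l) where

  open IsRgood rgood using (rootedBinaryTree; balanced)

  tree : IsTree R
  tree = proj₁ rootedBinaryTree

  open Sizes R tree
  open Cubic R tree

  degrees : degree R root ≡ 2 × (∀ v → v ≢ root → DegreeOneOrThree v)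
  degrees with proj₂ rootedBinaryTree
  ... | inj₁ refl = contradiction 3≤l (λ { (s≤s ()) })
  ... | inj₂ deg  = deg

  farthest-pendant : ∀ {y} → y ≢ root → (∀ x → dist root x ≤ dist root y) → degree R y ≡ 1
  farthest-pendant {y} y≢root y-max with proj₂ degrees y y≢root
  ... | inj₁ y≡1 = y≡1
  ... | inj₂ y≡3 with next y≢root
  ... | p , e , s with fork (adj-sym R e) y≡3
  ... | w , _ , f with side-total (Fork.adjacent₁ f) root
  ... | inj₁ t = contradiction (side-unique e (Fork.adjacent₁ f) s t) (Fork.not-parent f (here refl))
  ... | inj₂ t = contradiction (subst₂ _≤_ (dist-sym root w) (dist-sym root y) (y-max w))
                               (ℕ.<⇒≱ (ℕ.≤-reflexive t))

  -- In the application `suc h` is the exponent of the theorem and `M` is `⌈n/4⌉`. If some vertex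
  -- were higher than `suc h`, all leaves would have height at least `suc h` by balance. By
  -- `size-full` the subtree with the highest vertex then has at least `2^(h+1)` vertices, and so
  -- has the other one together with the root, whereas `l < 2 * 2^(h+1)`.
  height-≤ : ∀ {M h} → l ≡ suc (2 * M) → M < 2 ^ suc h → ∀ x → dist root x ≤ suc h
  height-≤ {M} {h} l≡ M< x = ℕ.≮⇒≥ too-high
    where
    y : Fin l
    y = proj₁ (argmax (dist root) root)
    y-max : ∀ x → dist root x ≤ dist root y
    y-max = proj₂ (argmax (dist root) root)
    too-high : ¬ suc h < dist root x
    too-high h<x = ℕ.<-irrefl refl (begin-strict
      2 ^ suc h + 2 ^ suc h                        ≤⟨ ℕ.+-mono-≤ (proj₂ full₁ w₁-closer (under w₁-closer h<y)) (proj₁ full₂) ⟩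
      size root w₁ + suc (size root w₂)            ≡⟨ cong (size root w₁ +_) size-root ⟨
      size root w₁ + size w₁ root                  ≡⟨ size-complement e₁ ⟨
      l                                            ≡⟨ l≡ ⟩
      suc (2 * M)                                  <⟨ ℕ.≤-reflexive (sym (ℕ.*-suc 2 M)) ⟩
      2 * suc M                                    ≤⟨ ℕ.*-monoʳ-≤ 2 M< ⟩
      2 * 2 ^ suc h                                ≡⟨ 2*≡+ (2 ^ suc h) ⟩
      2 ^ suc h + 2 ^ suc h                        ∎)
      where
      open ℕ.≤-Reasoning
      h<y : suc h < dist root y
      h<y = ℕ.<-≤-trans h<x (y-max x)
      y≢root : y ≢ root
      y≢root y≡ = contradiction (ℕ.<-≤-trans h<y (ℕ.≤-reflexive (trans (cong (dist root) y≡) (dist-refl root)))) (λ ())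
      low : ∀ {v} → degree R v ≡ 1 → suc h ≤ dist root v
      low {v} v≡1 = ℕ.≤-pred (begin
        suc (suc h)                                        ≤⟨ h<y ⟩
        dist root y                                        ≤⟨ ℕ.m≤n+m∸n (dist root y) (dist root v) ⟩
        dist root v + (dist root y ∸ dist root v)          ≤⟨ ℕ.+-monoʳ-≤ (dist root v) (ℕ.≤-trans (ℕ.m∸n≤∣m-n∣ (dist root y) (dist root v))
                                                                (balanced (farthest-pendant y≢root y-max) v≡1 (dist-isDist root y) (dist-isDist root v))) ⟩
        dist root v + 1                                    ≡⟨ ℕ.+-comm _ 1 ⟩
        suc (dist root v)                                  ∎)
      top : ∃[ w ] Adj R root w × Side root w y
      top = next (y≢root ∘ sym)
      w₁ : Fin l
      w₁ = proj₁ top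
      e₁ : Adj R root w₁
      e₁ = proj₁ (proj₂ top)
      w₁-closer : Side root w₁ y
      w₁-closer = proj₂ (proj₂ top)
      other-child : ∃[ w₂ ] Children w₁ root (w₂ ∷ [])
      other-child with children e₁
      ... | ws , ch , len with ws | ch | trans len (proj₁ degrees)
      ... | w₂ ∷ [] | ch′ | _ = w₂ , ch′
      w₂ : Fin l
      w₂ = proj₁ other-child
      e₂ : Adj R root w₂
      e₂ = Children.adjacent (proj₂ other-child) (here refl)
      size-root : size w₁ root ≡ suc (size root w₂)
      size-root = trans (size-children (proj₂ other-child)) (cong suc (ℕ.+-identityʳ _))
      under : ∀ {w v k} → Side root w v → suc k ≤ dist root v → k ≤ dist w v
      under s ≤v = ℕ.≤-pred (ℕ.≤-trans ≤v (ℕ.≤-reflexive (sym s)))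
      -- The root is the one vertex that breaks the degree condition, and it lies on no side
      -- `root w`.
      full : ∀ {w} → Adj R root w → 2 ^ suc h ≤ suc (size root w) ×
             (∀ {x} → Side root w x → h < dist w x → 2 ^ suc h ≤ size root w)
      full e = size-full e (λ {v} s → proj₂ degrees v (side-≢ s ∘ sym)) h (λ s v≡1 → under s (low v≡1))
      full₁ : 2 ^ suc h ≤ suc (size root w₁) ×
             (∀ {x} → Side root w₁ x → h < dist w₁ x → 2 ^ suc h ≤ size root w₁)
      full₁ = full e₁
      full₂ : 2 ^ suc h ≤ suc (size root w₂) ×
             (∀ {x} → Side root w₂ x → h < dist w₂ x → 2 ^ suc h ≤ size root w₂)
      full₂ = full e₂

-- Gluing two trees at a vertex

identification-swap : ∀ {n m k} {G : Graph n} {H : Graph m} {a} {K : Graph k} {b} →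
                      IsIdentification G H a K b → IsIdentification G K b H a
identification-swap i = record
  { f = I.g ; g = I.f ; f-inj = I.g-inj ; g-inj = I.f-inj ; cover = swap ∘ I.cover
  ; glue = sym I.glue ; meet = λ eq → let (p , q) = I.meet (sym eq) in q , p
  ; f-adj = I.g-adj ; g-adj = I.f-adj ; adj = swap ∘ I.adj
  }
  where module I = IsIdentification i

module Glued {n m k : ℕ} {G : Graph n} {H : Graph m} {a : Fin m} {K : Graph k} {b : Fin k}
             (connG : ConnectedOn G ⊤) (connH : ConnectedOn H ⊤) (connK : ConnectedOn K ⊤)
             (ident : IsIdentification G H a K b) where

  open IsIdentification ident
  private
    module G = Distance G connG
    module H = Distance H connH
    module K = Distance K connK

  dist-f : ∀ x x′ → G.dist (f x) (f x′) ≤ H.dist x x′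
  dist-f x x′ = G.dist-≤ (map-walk (H.dist-walk x x′))
    where
    map-walk : ∀ {x x′ j} → Walk H x x′ j → Walk G (f x) (f x′) j
    map-walk []      = []
    map-walk (e ∷ p) = f-adj e ∷ map-walk p

  -- The retraction of G onto K that collapses H to the glued vertex.
  Shadow : Fin n → Fin k → Set
  Shadow v y = g y ≡ v ⊎ (y ≡ b × ∃[ x ] f x ≡ v)

  shadow : ∀ v → ∃ (Shadow v)
  shadow v with cover v
  ... | inj₁ x∈        = b , inj₂ (refl , x∈)
  ... | inj₂ (y , gy≡) = y , inj₁ gy≡

  shadow-unique : ∀ {v y y′} → Shadow v y → Shadow v y′ → y ≡ y′
  shadow-unique (inj₁ p)              (inj₁ q)              = g-inj (trans p (sym q))
  shadow-unique (inj₁ p)              (inj₂ (refl , x , q)) = proj₂ (meet (trans q (sym p)))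
  shadow-unique (inj₂ (refl , x , p)) (inj₁ q)              = sym (proj₂ (meet (trans p (sym q))))
  shadow-unique (inj₂ (refl , _))     (inj₂ (refl , _))     = refl

  shadow-adj : ∀ {u v y y′} → Adj G u v → Shadow u y → Shadow v y′ → y ≡ y′ ⊎ Adj K y y′
  shadow-adj e s t with adj e
  ... | inj₁ (x , x′ , p , q , _) =
    inj₁ (trans (shadow-unique s (inj₂ (refl , x , p))) (shadow-unique (inj₂ (refl , x′ , q)) t))
  ... | inj₂ (y , y′ , p , q , d) with shadow-unique s (inj₁ p) | shadow-unique t (inj₁ q)
  ... | refl | refl = inj₂ d

  -- Each edge is mapped to an edge of `K` or collapsed to a vertex, so walks do not get longer.
  shadow-dist : ∀ {u v y y′} → Shadow u y → Shadow v y′ → K.dist y y′ ≤ G.dist u v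
  shadow-dist s t = go (G.dist-walk _ _) s t
    where
    go : ∀ {u v j y y′} → Walk G u v j → Shadow u y → Shadow v y′ → K.dist y y′ ≤ j
    go {y = y} [] s t = ℕ.≤-reflexive (trans (cong (K.dist y) (sym (shadow-unique s t))) (K.dist-refl y))
    go (_∷_ {v = w} e p) s t with shadow w
    ... | z , s′ with shadow-adj e s s′
    ...   | inj₁ refl = ℕ.m≤n⇒m≤1+n (go p s′ t)
    ...   | inj₂ d    = ℕ.≤-trans (K.dist-adj d _) (s≤s (go p s′ t))

  dist-across : ∀ x y → K.dist b y ≤ G.dist (f x) (g y)
  dist-across x y = shadow-dist (inj₂ (refl , x , refl)) (inj₁ refl)

module _ {n : ℕ} (G : Graph n) (conn : ConnectedOn G ⊤) where

  open Distance G conn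

  along-geodesic : ∀ u x j → j ≤ dist u x → ∃[ z ] dist u z ≤ j × j + dist z x ≡ dist u x
  along-geodesic u x zero    _    = u , ℕ.≤-reflexive (dist-refl u) , refl
  along-geodesic u x (suc j) j<ux with along-geodesic u x j (ℕ.<⇒≤ j<ux)
  ... | z , uz≤j , sum with dist z x in zx
  ... | zero = contradiction (trans (sym sum) (ℕ.+-identityʳ j)) (ℕ.>⇒≢ j<ux)
  ... | suc i with step zx
  ... | z′ , e , z′x = z′ , (begin
      dist u z′      ≡⟨ dist-sym u z′ ⟩
      dist z′ u      ≤⟨ dist-adj (adj-sym G e) u ⟩
      suc (dist z u) ≡⟨ cong suc (dist-sym z u) ⟩
      suc (dist u z) ≤⟨ s≤s uz≤j ⟩
      suc j          ∎) ,
    trans (cong (suc j +_) z′x) (trans (sym (ℕ.+-suc j i)) sum)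
    where open ℕ.≤-Reasoning

-- By w-far, Q = dist b w below is both the diameter of K and the eccentricity of b in K.
module GluedExtremes {n m k : ℕ} {G : Graph n} {H : Graph m} {a : Fin m} {K : Graph k} {b : Fin k}
  (treeG : IsTree G) (treeH : IsTree H) (treeK : IsTree K) (ident : IsIdentification G H a K b)
  (x₀ : Fin n) (neighbour : ∀ v → ∃ (Adj G v))
  {h : ℕ} (height-≤ : ∀ x → Distance.dist H (proj₁ treeH) a x ≤ h) (heavy : n < 2 * m)
  {w : Fin k} (w-far : ∀ y y′ → Distance.dist K (proj₁ treeK) y y′ ≤ Distance.dist K (proj₁ treeK) b w)
  where

  open IsIdentification ident

  r : Fin n
  r = f a

  open Extremes G treeG x₀ neighbour
  open Glued (proj₁ treeG) (proj₁ treeH) (proj₁ treeK) ident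
  private
    module H = Distance H (proj₁ treeH)
    module K = Distance K (proj₁ treeK)
    module Swapped = Glued (proj₁ treeG) (proj₁ treeK) (proj₁ treeH) (identification-swap ident)

  Q : ℕ
  Q = K.dist b w

  dist-g : ∀ y y′ → dist (g y) (g y′) ≤ K.dist y y′
  dist-g = Swapped.dist-f

  -- Seen from a vertex outside `H`, all of `H` lies on the side of the next vertex toward `r`. That
  -- side has more than half of the vertices, so this step lowers the weight.
  centroid-in-H : ∀ {c} → MinimalFor weight c → ∃[ x ] f x ≡ c
  centroid-in-H {c} c-min with cover c
  ... | inj₁ x∈ = x∈
  ... | inj₂ (y , refl) with y Fin.≟ b
  ... | yes refl = a , glue
  ... | no y≢b with next {u = g y} {x = r} (λ gy≡fa → y≢b (proj₂ (meet (sym gy≡fa))))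
  ... | c′ , e , s = contradiction (c-min c′) (ℕ.<⇒≱ (size-<⇒weight-< e light))
    where
    open ℕ.≤-Reasoning
    -- No neighbour of `r` leads both ways: collapsing `H` shows that one in `H` is no closer to
    -- `g y` than `r`, and collapsing `K` that one in `K` is no closer to `f x`.
    through-r : ∀ x → dist (g y) (f x) ≡ dist (g y) r + dist r (f x)
    through-r x = dist-through λ {v} d t t′ → [ in-H t , in-K t′ ]′ (cover v)
      where
      in-H : ∀ {v} → Side r v (g y) → ∃[ x′ ] f x′ ≡ v → ⊥
      in-H t (x′ , refl) = ℕ.<-irrefl refl (begin-strict
        dist (f x′) (g y)  <⟨ ℕ.≤-reflexive t ⟩
        dist r (g y)       ≡⟨ cong (λ v → dist v (g y)) glue ⟩
        dist (g b) (g y)   ≤⟨ dist-g b y ⟩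
        K.dist b y         ≤⟨ dist-across x′ y ⟩
        dist (f x′) (g y)  ∎)
      in-K : ∀ {v} → Side r v (f x) → ∃[ y′ ] g y′ ≡ v → ⊥
      in-K t (y′ , refl) = ℕ.<-irrefl refl (begin-strict
        dist (g y′) (f x)  <⟨ ℕ.≤-reflexive t ⟩
        dist r (f x)       ≤⟨ dist-f a x ⟩
        H.dist a x         ≤⟨ Swapped.dist-across y′ x ⟩
        dist (g y′) (f x)  ∎)
    H-side : ∀ x → Side (g y) c′ (f x)
    H-side x = ℕ.≤-antisym (begin
      suc (dist c′ (f x))           ≤⟨ s≤s (dist-triangle c′ r (f x)) ⟩
      suc (dist c′ r) + dist r (f x) ≡⟨ cong (_+ dist r (f x)) s ⟩
      dist (g y) r + dist r (f x)   ≡⟨ through-r x ⟨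
      dist (g y) (f x)              ∎) (dist-adj e (f x))
    m≤size : m ≤ size (g y) c′
    m≤size = begin
      m                            ≡⟨ List.length-tabulate {n = m} id ⟨
      length (allFin m)            ≡⟨ List.length-map f (allFin m) ⟨
      length (map f (allFin m))    ≤⟨ unique-length-≤ (Unique.map⁺ f-inj (Unique.allFin⁺ m)) included ⟩
      size (g y) c′                ∎
      where
      included : ∀ {v} → v ∈ˡ map f (allFin m) → v ∈ˡ side (g y) c′
      included v∈ with ∈-map⁻ f v∈
      ... | x , _ , refl = ∈-side⁺ (H-side x)
    light : size c′ (g y) < size (g y) c′
    light = ℕ.+-cancelˡ-< (size (g y) c′) _ _ (begin-strict
      size (g y) c′ + size c′ (g y)  ≡⟨ size-complement e ⟨
      n                              <⟨ heavy ⟩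
      2 * m                          ≤⟨ ℕ.*-monoʳ-≤ 2 m≤size ⟩
      2 * size (g y) c′              ≡⟨ 2*≡+ (size (g y) c′) ⟩
      size (g y) c′ + size (g y) c′  ∎)

  dist-r-gw : dist r (g w) ≡ Q
  dist-r-gw = ℕ.≤-antisym
    (ℕ.≤-trans (ℕ.≤-reflexive (cong (λ v → dist v (g w)) glue)) (dist-g b w))
    (dist-across a w)

  module _ {φ : ℕ} (2φ+h≤Q : 2 * φ + h ≤ Q) where

    open ℕ.≤-Reasoning

    φ+φ≤Q : φ + φ ≤ Q
    φ+φ≤Q = ℕ.≤-trans (ℕ.≤-trans (ℕ.≤-reflexive (sym (2*≡+ φ))) (ℕ.m≤m+n (2 * φ) h)) 2φ+h≤Q

    φ≤Q : φ ≤ Q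
    φ≤Q = ℕ.m+n≤o⇒m≤o φ φ+φ≤Q

    middle : ∃[ z ] dist r z ≤ φ × φ + dist z (g w) ≡ dist r (g w)
    middle = along-geodesic G (proj₁ treeG) r (g w) φ (ℕ.≤-trans φ≤Q (ℕ.≤-reflexive (sym dist-r-gw)))

    z : Fin n
    z = proj₁ middle

    rz≤φ : dist r z ≤ φ
    rz≤φ = proj₁ (proj₂ middle)

    φ+zw≡Q : φ + dist z (g w) ≡ Q
    φ+zw≡Q = trans (proj₂ (proj₂ middle)) dist-r-gw

    φ≤rz : φ ≤ dist r z
    φ≤rz = ℕ.+-cancelʳ-≤ (dist z (g w)) _ _ (begin
      φ + dist z (g w)         ≡⟨ proj₂ (proj₂ middle) ⟩
      dist r (g w)             ≤⟨ dist-triangle r z (g w) ⟩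
      dist r z + dist z (g w)  ∎)

    -- For `t` in `H`, pass through `r`, at cost at most `φ + h`. For `t` in `K`, look at the first
    -- step from `z` to `t`. If it is not toward `r`, then `z` lies between `r` and `t`, and
    -- `φ + dist z t` is a distance from `r`. If it is, then `z` lies between `t` and `g w`, and the
    -- diameter of `K` leaves at most `φ` for `dist z t`.
    middle-dist : ∀ t → φ + dist z t ≤ Q
    middle-dist t with cover t
    ... | inj₁ (x , refl) = begin
      φ + dist z (f x)               ≤⟨ ℕ.+-monoʳ-≤ φ (dist-triangle z r (f x)) ⟩
      φ + (dist z r + dist r (f x))  ≤⟨ ℕ.+-monoʳ-≤ φ (ℕ.+-mono-≤ (ℕ.≤-trans (ℕ.≤-reflexive (dist-sym z r)) rz≤φ) (ℕ.≤-trans (dist-f a x) (height-≤ x))) ⟩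
      φ + (φ + h)                    ≡⟨ ℕ.+-assoc φ φ h ⟨
      φ + φ + h                      ≡⟨ cong (_+ h) (2*≡+ φ) ⟨
      2 * φ + h                      ≤⟨ 2φ+h≤Q ⟩
      Q                              ∎
    ... | inj₂ (y , refl) with z Fin.≟ g y
    ...   | yes z≡t = begin
      φ + dist z (g y)  ≡⟨ cong (λ v → φ + dist z v) z≡t ⟨
      φ + dist z z      ≡⟨ cong (φ +_) (dist-refl z) ⟩
      φ + 0             ≡⟨ ℕ.+-identityʳ φ ⟩
      φ                 ≤⟨ φ≤Q ⟩
      Q                 ∎
    ...   | no z≢t with next z≢t
    ...   | p , e , s with side? z p r
    ...     | no ¬sr = begin
      φ + dist z (g y)         ≡⟨ ℕ.+-comm φ _ ⟩
      dist z (g y) + φ         ≡⟨ cong (_+ φ) (dist-sym z (g y)) ⟩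
      dist (g y) z + φ         ≤⟨ ℕ.+-monoʳ-≤ (dist (g y) z) (ℕ.≤-trans φ≤rz (ℕ.≤-reflexive (dist-sym r z))) ⟩
      dist (g y) z + dist z r  ≡⟨ dist-through (λ d t t′ → ¬sr (subst (λ v → Side z v r) (side-unique d e t s) t′)) ⟨
      dist (g y) r             ≡⟨ cong (dist (g y)) glue ⟩
      dist (g y) (g b)         ≤⟨ dist-g y b ⟩
      K.dist y b               ≤⟨ w-far y b ⟩
      Q                        ∎
    ...     | yes sr = begin
      φ + dist z (g y)  ≡⟨ cong (φ +_) (dist-sym z (g y)) ⟩
      φ + dist (g y) z  ≤⟨ ℕ.+-monoʳ-≤ φ yz≤φ ⟩
      φ + φ             ≤⟨ φ+φ≤Q ⟩
      Q                 ∎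
      where
      -- `z` is on a geodesic from `r` to `g w`, so no neighbour of `z` is nearer to both ends.
      ¬sw : ¬ Side z p (g w)
      ¬sw sw = ℕ.<-irrefl refl (begin-strict
        dist r (g w)                 ≤⟨ dist-triangle r p (g w) ⟩
        dist r p + dist p (g w)      ≡⟨ cong (_+ dist p (g w)) (dist-sym r p) ⟩
        dist p r + dist p (g w)      <⟨ ℕ.+-mono-< (ℕ.≤-reflexive sr) (ℕ.≤-reflexive sw) ⟩
        dist z r + dist z (g w)      ≤⟨ ℕ.+-monoˡ-≤ (dist z (g w)) (ℕ.≤-trans (ℕ.≤-reflexive (dist-sym z r)) rz≤φ) ⟩
        φ + dist z (g w)             ≡⟨ proj₂ (proj₂ middle) ⟩
        dist r (g w)                 ∎)
      yz≤φ : dist (g y) z ≤ φ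
      yz≤φ = ℕ.+-cancelʳ-≤ (dist z (g w)) _ _ (begin
        dist (g y) z + dist z (g w)  ≡⟨ dist-through (λ d t t′ → ¬sw (subst (λ v → Side z v (g w)) (side-unique d e t s) t′)) ⟨
        dist (g y) (g w)             ≤⟨ ℕ.≤-trans (dist-g y w) (w-far y w) ⟩
        Q                            ≡⟨ φ+zw≡Q ⟨
        φ + dist z (g w)             ∎)

    -- For a central `x`, `φ + ecc x ≤ φ + ecc z ≤ Q ≤ dist c (g w) ≤ dist x c + ecc
    -- x`, and the unknown eccentricity of `x` cancels.
    center-centroid-≥ : ∀ {x c} → MinimalFor ecc x → MinimalFor weight c → φ ≤ dist x c
    center-centroid-≥ {x} {c} x-min c-min with centroid-in-H c-min
    ... | x′ , refl = ℕ.+-cancelʳ-≤ (ecc x) _ _ (begin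
      φ + ecc x                         ≤⟨ ℕ.+-monoʳ-≤ φ (x-min z) ⟩
      φ + ecc z                         ≤⟨ middle-dist (far z) ⟩
      Q                                 ≤⟨ dist-across x′ w ⟩
      dist (f x′) (g w)                 ≤⟨ dist-triangle (f x′) x (g w) ⟩
      dist (f x′) x + dist x (g w)      ≤⟨ ℕ.+-mono-≤ (ℕ.≤-reflexive (dist-sym (f x′) x)) (dist≤ecc x (g w)) ⟩
      dist x (f x′) + ecc x             ∎)

-- Arithmetic of the bound

module _ where

  open +-*-Solver
  open ℕ.≤-Reasoning

  quotient-≤ : ∀ {k m} d .{{_ : NonZero d}} → k * d ≤ m → k ≤ m / d
  quotient-≤ {k} d kd≤m = ℕ.≤-trans (ℕ.≤-reflexive (sym (ℕ.m*n/n≡m k d))) (ℕ./-monoˡ-≤ d kd≤m)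

  <-suc-quotient : ∀ m d .{{_ : NonZero d}} → m < suc (m / d) * d
  <-suc-quotient m d = begin-strict
    m                    ≡⟨ ℕ.m≡m%n+[m/n]*n m d ⟩
    m ℕ.% d + m / d * d  <⟨ ℕ.+-monoˡ-< (m / d * d) (ℕ.m%n<n m d) ⟩
    d + m / d * d        ∎

  n≤4⌈n/4⌉ : ∀ n → n ≤ 4 * ⌈ n /4⌉
  n≤4⌈n/4⌉ n = ℕ.+-cancelʳ-≤ 4 n (4 * ⌈ n /4⌉) (begin
    n + 4              ≡⟨ ℕ.+-suc n 3 ⟩
    suc (n + 3)        ≤⟨ <-suc-quotient (n + 3) 4 ⟩
    4 + ⌈ n /4⌉ * 4    ≡⟨ solve 1 (λ m → con 4 :+ m :* con 4 := con 4 :* m :+ con 4) refl ⌈ n /4⌉ ⟩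
    4 * ⌈ n /4⌉ + 4    ∎)

  ⌈n/4⌉≤1+n/4 : ∀ n → ⌈ n /4⌉ ≤ suc (n / 4)
  ⌈n/4⌉≤1+n/4 n = ℕ.≤-pred (ℕ.m<n*o⇒m/o<n {n + 3} {suc (suc (n / 4))} {4} (begin-strict
    n + 3                ≡⟨ ℕ.+-comm n 3 ⟩
    3 + n                <⟨ ℕ.+-mono-≤-< (ℕ.m≤n+m 3 1) (<-suc-quotient n 4) ⟩
    4 + suc (n / 4) * 4  ∎))

  2+n≤2^n : ∀ n → 2 ≤ n → 2 + n ≤ 2 ^ n
  2+n≤2^n (suc zero)          (s≤s ())
  2+n≤2^n (suc (suc zero))    _ = ℕ.≤-refl
  2+n≤2^n (suc k@(suc (suc _))) _ = begin
    1 + (2 + k)      ≤⟨ ℕ.+-mono-≤ (ℕ.m^n>0 2 k) (2+n≤2^n k (s≤s (s≤s z≤n))) ⟩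
    2 ^ k + 2 ^ k    ≡⟨ 2*≡+ (2 ^ k) ⟨
    2 ^ suc k        ∎

  odd+odd : ∀ a b → suc (2 * b) + suc (2 * a) ≡ 2 * suc (b + a)
  odd+odd = solve 2 (λ a b → con 1 :+ con 2 :* b :+ (con 1 :+ con 2 :* a)
                             := con 2 :* (con 1 :+ (b :+ a))) refl

  -- For even `n` the two quotients add up to exactly `n/2`; the estimate fails for `n` congruent to
  -- 1 modulo 4.
  ⌈n/4⌉+n/4≤n/2 : ∀ {n N} → n ≡ 2 * N → 2 * (⌈ n /4⌉ + n / 4) ≤ n
  ⌈n/4⌉+n/4≤n/2 {n} {N} refl = ℕ.*-monoʳ-≤ 2 (ℕ.≤-pred (ℕ.*-cancelˡ-< 4 (M + q) (suc N) (begin-strict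
    4 * (M + q)              ≡⟨ solve 2 (λ M q → con 4 :* (M :+ q) := M :* con 4 :+ q :* con 4) refl M q ⟩
    M * 4 + q * 4            ≤⟨ ℕ.+-mono-≤ (ℕ.m/n*n≤m (2 * N + 3) 4) (ℕ.m/n*n≤m (2 * N) 4) ⟩
    2 * N + 3 + 2 * N        <⟨ ℕ.≤-reflexive (solve 1 (λ N → con 1 :+ (con 2 :* N :+ con 3 :+ con 2 :* N) := con 4 :* (con 1 :+ N)) refl N) ⟩
    4 * suc N                ∎)))
    where
    M q : ℕ
    M = ⌈ 2 * N /4⌉
    q = 2 * N / 4

  module _ {q h s : ℕ} (s≡ : (q + 1 + h) / 2 ≡ s) where

    -- Here d ≤ q - s, and q - s itself satisfies the hypothesis by difference-bound;
    -- that is, q - ⌊(q+1+h)/2⌋ = ⌊(q-h)/2⌋.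
    difference-≥ : ∀ {d} → 2 * d + h ≤ q → d + s ≤ q
    difference-≥ {d} 2d+h≤q = begin
      d + s        ≤⟨ ℕ.+-monoʳ-≤ d s≤e ⟩
      d + (q ∸ d)  ≡⟨ ℕ.m+[n∸m]≡n d≤q ⟩
      q            ∎
      where
      d≤q : d ≤ q
      d≤q = ℕ.≤-trans (ℕ.m≤m+n d (d + 0)) (ℕ.m+n≤o⇒m≤o (2 * d) 2d+h≤q)
      e : ℕ
      e = q ∸ d
      d+h≤e : d + h ≤ e
      d+h≤e = ℕ.+-cancelˡ-≤ d (d + h) e (begin
        d + (d + h)  ≡⟨ solve 2 (λ d h → d :+ (d :+ h) := con 2 :* d :+ h) refl d h ⟩
        2 * d + h    ≤⟨ 2d+h≤q ⟩
        q            ≡⟨ ℕ.m+[n∸m]≡n d≤q ⟨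
        d + e        ∎)
      s≤e : s ≤ e
      s≤e = subst (_≤ e) s≡ (ℕ.≤-pred (ℕ.m<n*o⇒m/o<n {q + 1 + h} {suc e} {2} (begin-strict
        q + 1 + h        ≡⟨ cong (λ m → m + 1 + h) (ℕ.m+[n∸m]≡n d≤q) ⟨
        d + e + 1 + h    ≡⟨ solve 3 (λ d e h → d :+ e :+ con 1 :+ h := con 1 :+ (d :+ h :+ e)) refl d e h ⟩
        suc (d + h + e)  ≤⟨ s≤s (ℕ.+-monoˡ-≤ e d+h≤e) ⟩
        suc (e + e)      <⟨ ℕ.≤-reflexive (solve 1 (λ e → con 2 :+ (e :+ e) := (con 1 :+ e) :* con 2) refl e) ⟩
        suc e * 2        ∎)))

    difference-bound : s ≤ q → 2 * (q ∸ s) + h ≤ q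
    difference-bound s≤q = ℕ.+-cancelˡ-≤ q _ _ (begin
      q + (2 * (q ∸ s) + h)  ≡⟨ solve 3 (λ q p h → q :+ (con 2 :* p :+ h) := con 2 :* p :+ (q :+ h)) refl q (q ∸ s) h ⟩
      2 * (q ∸ s) + (q + h)  ≤⟨ ℕ.+-monoʳ-≤ (2 * (q ∸ s)) q+h≤2s ⟩
      2 * (q ∸ s) + 2 * s    ≡⟨ ℕ.*-distribˡ-+ 2 (q ∸ s) s ⟨
      2 * (q ∸ s + s)        ≡⟨ cong (2 *_) (ℕ.m∸n+n≡m s≤q) ⟩
      2 * q                  ≡⟨ 2*≡+ q ⟩
      q + q                  ∎)
      where
      q+h≤2s : q + h ≤ 2 * s
      q+h≤2s = ℕ.≤-pred (ℕ.≤-pred (begin-strict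
        suc (q + h)  ≡⟨ solve 2 (λ q h → con 1 :+ (q :+ h) := q :+ con 1 :+ h) refl q h ⟩
        q + 1 + h    <⟨ <-suc-quotient (q + 1 + h) 2 ⟩
        2 + (q + 1 + h) / 2 * 2  ≡⟨ cong (λ s → 2 + s * 2) s≡ ⟩
        2 + s * 2    ≡⟨ cong (2 +_) (ℕ.*-comm s 2) ⟩
        2 + 2 * s    ∎))

-- Arithmetic of the level `h`

module Levels {n : ℕ} (12≤n : 12 ≤ n) {h : ℕ}
              (h-min : IsMin (λ k → 1 ≤ k × ⌈ n /4⌉ ≤ 2 ^ k ∸ 1) h) where

  open ℕ.≤-Reasoning

  3≤n/4 : 3 ≤ n / 4
  3≤n/4 = quotient-≤ 4 12≤n

  -- The exponent `n / 4` is itself admissible. The inequality makes the claimed bound nonnegative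
  -- and settles the case of distance 0.
  h≤n/4 : h ≤ n / 4
  h≤n/4 = proj₂ h-min (n / 4) (ℕ.≤-trans (s≤s z≤n) 3≤n/4 , ℕ.m+n≤o⇒m≤o∸n ⌈ n /4⌉ (begin
    ⌈ n /4⌉ + 1    ≡⟨ ℕ.+-comm _ 1 ⟩
    suc ⌈ n /4⌉    ≤⟨ s≤s (⌈n/4⌉≤1+n/4 n) ⟩
    2 + n / 4      ≤⟨ 2+n≤2^n (n / 4) (ℕ.<⇒≤ 3≤n/4) ⟩
    2 ^ (n / 4)    ∎))

  ⌈n/4⌉<2^h : ⌈ n /4⌉ < 2 ^ h
  ⌈n/4⌉<2^h = begin-strict
    ⌈ n /4⌉          <⟨ s≤s (proj₂ (proj₁ h-min)) ⟩
    suc (2 ^ h ∸ 1)  ≡⟨ ℕ.+-comm 1 (2 ^ h ∸ 1) ⟩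
    2 ^ h ∸ 1 + 1    ≡⟨ ℕ.m∸n+n≡m (ℕ.m^n>0 2 h) ⟩
    2 ^ h            ∎

  predecessor : ∃[ h′ ] h ≡ suc h′
  predecessor = pred h , sym (ℕ.suc-pred h {{>-nonZero (proj₁ (proj₁ h-min))}})

  -- This is minimality of `h` tested at `h - 1`. For `h = 1` that exponent is not positive, and
  -- `⌈n/4⌉ ≥ 1` takes its place.
  2^[h-1]≤⌈n/4⌉ : ∀ {h′} → h ≡ suc h′ → 2 ^ h′ ≤ ⌈ n /4⌉
  2^[h-1]≤⌈n/4⌉ {zero}   _    = ℕ.*-cancelˡ-< 4 0 ⌈ n /4⌉ (ℕ.<-≤-trans (ℕ.<-≤-trans (s≤s z≤n) 12≤n) (n≤4⌈n/4⌉ n))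
  2^[h-1]≤⌈n/4⌉ {suc h′} refl = ℕ.≮⇒≥ λ <2^ → ℕ.<-irrefl refl
    (proj₂ h-min (suc h′) (s≤s z≤n , ℕ.m+n≤o⇒m≤o∸n ⌈ n /4⌉ (ℕ.≤-trans (ℕ.≤-reflexive (ℕ.+-comm _ 1)) <2^)))

  module _ {a b : ℕ} (n≡ : n ≡ suc (2 * b) + suc (2 * a)) (b<a : b < a) where

    open +-*-Solver

    lighter≤n/4 : suc b ≤ n / 4
    lighter≤n/4 = quotient-≤ 4 (begin
      suc b * 4                  ≡⟨ solve 1 (λ b → (con 1 :+ b) :* con 4 := con 2 :* (con 1 :+ (b :+ (con 1 :+ b)))) refl b ⟩
      2 * suc (b + suc b)        ≤⟨ ℕ.*-monoʳ-≤ 2 (s≤s (ℕ.+-monoʳ-≤ b b<a)) ⟩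
      2 * suc (b + a)            ≡⟨ odd+odd a b ⟨
      suc (2 * b) + suc (2 * a)  ≡⟨ n≡ ⟨
      n                          ∎)

    ⌈n/4⌉≤a : ⌈ n /4⌉ ≤ a
    ⌈n/4⌉≤a = ℕ.≤-pred (ℕ.m<n*o⇒m/o<n {n + 3} {suc a} {4} (begin-strict
      n + 3                  ≡⟨ cong (_+ 3) (trans n≡ (odd+odd a b)) ⟩
      2 * suc (b + a) + 3    ≤⟨ ℕ.+-monoˡ-≤ 3 (ℕ.*-monoʳ-≤ 2 (ℕ.+-monoˡ-≤ a b<a)) ⟩
      2 * (a + a) + 3        <⟨ ℕ.≤-reflexive (solve 1 (λ a → con 1 :+ (con 2 :* (a :+ a) :+ con 3) := (con 1 :+ a) :* con 4) refl a) ⟩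
      suc a * 4              ∎))

    2^h≤heavier : 2 ^ h ≤ suc (2 * a)
    2^h≤heavier = begin
      2 ^ h                        ≡⟨ cong (2 ^_) (proj₂ predecessor) ⟩
      2 ^ suc (proj₁ predecessor)  ≤⟨ ℕ.*-monoʳ-≤ 2 (ℕ.≤-trans (2^[h-1]≤⌈n/4⌉ (proj₂ predecessor)) ⌈n/4⌉≤a) ⟩
      2 * a                        ≤⟨ ℕ.n≤1+n _ ⟩
      suc (2 * a)                  ∎

-- Lower bound for crg trees and assembly of the theorem

module Crg {n : ℕ} {T : Graph n} (tree : IsTree T) (x₀ : Fin n) (neighbour : ∀ v → ∃ (Adj T v))
           {l : ℕ} (crg : IsCrg l T) where

  open IsCrg crg

  module ET = Extremes T tree x₀ neighbour

  treeR : IsTree R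
  treeR = Rgood.tree R root rgood 3≤l

  treeK : IsTree K
  treeK = Caterpillar.tree K caterpillar

  module _ {q M h : ℕ} (3≤q : 3 ≤ q) (2q≤k : 2 * q ≤ n ∸ l + 1) (l≡ : l ≡ suc (2 * M))
           (M< : M < 2 ^ suc h) (n<2l : n < 2 * l) where

    3≤k : 3 ≤ n ∸ l + 1
    3≤k = ℕ.≤-trans 3≤q (ℕ.≤-trans (ℕ.m≤m+n q (q + 0)) 2q≤k)

    neighbourK : ∀ v → ∃ (Adj K v)
    neighbourK v with Distance.next K (proj₁ treeK) (proj₂ (another (ℕ.<⇒≤ 3≤k) v))
    ... | u , e , _ = u , e

    module EK = Extremes K treeK tip neighbourK

    w-far : ∀ y y′ → EK.dist y y′ ≤ EK.dist tip (EK.far tip)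
    w-far y y′ = ℕ.≤-trans (EK.dist≤ecc y y′)
      (maximizer⁻ EK.ecc EK.ecc-isEccentricity EK.ecc-functional tip-maxEcc y)

    q≤Q : q ≤ EK.ecc tip
    q≤Q with Caterpillar.long K caterpillar 3≤k tip
    ... | x , y , k≤ = ℕ.*-cancelˡ-≤ 2 (ℕ.≤-trans 2q≤k (ℕ.≤-trans k≤ (ℕ.*-monoʳ-≤ 2 (w-far x y))))

    crg-lower-bound : ∀ {φ} → 2 * φ + suc h ≤ q → ∀ {z c} → ET.Nearest z c → φ ≤ ET.dist z c
    crg-lower-bound {φ} 2φ+h≤q near =
      GluedExtremes.center-centroid-≥ tree treeR treeK identification x₀ neighbour {h = suc h}
        (Rgood.height-≤ R root rgood 3≤l l≡ M<) n<2l {w = EK.far tip} w-far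
        {φ = φ} (ℕ.≤-trans 2φ+h≤q q≤Q) (ET.Nearest.center near) (ET.Nearest.centroid near)

module Main {n : ℕ} (T : Graph n) (binary : IsBinaryTree T) (12≤n : 12 ≤ n) {h : ℕ}
            (h-min : IsMin (λ k → 1 ≤ k × ⌈ n /4⌉ ≤ 2 ^ k ∸ 1) h) where

  open Levels 12≤n h-min
  open ℕ.≤-Reasoning

  tree : IsTree T
  tree = proj₁ binary

  x₀ : Fin n
  x₀ = Fin.fromℕ< {0} (ℕ.<-≤-trans (s≤s z≤n) 12≤n)

  neighbour : ∀ v → ∃ (Adj T v)
  neighbour v with Distance.next T (proj₁ tree) (proj₂ (another (ℕ.≤-trans (s≤s (s≤s z≤n)) 12≤n) v))
  ... | u , e , _ = u , e

  open Extremes T tree x₀ neighbour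
  open Cubic T tree

  cubic : ∀ v → DegreeOneOrThree v
  cubic = binary⇒cubic binary

  even : ∃[ N ] n ≡ 2 * N
  even with neighbour x₀
  ... | v , e with size-odd e (λ {x} _ → cubic x) | size-odd (adj-sym T e) (λ {x} _ → cubic x)
  ... | b , size-b | a , size-a =
    suc (b + a) , trans (trans (size-complement e) (cong₂ _+_ size-b size-a)) (odd+odd a b)

  upper-bound : ∀ {z c} → Nearest z c → 2 * dist z c + h ≤ n / 4
  upper-bound {z} {c} near with z Fin.≟ c
  ... | yes refl = ℕ.≤-trans (ℕ.≤-reflexive (cong (λ d → 2 * d + h) (dist-refl z))) h≤n/4
  ... | no z≢c =
    let a , b , n≡ , b<a , bound = nearest-bound near z≢c cubic
    in ℕ.≤-trans (bound h (2^h≤heavier n≡ b<a)) (lighter≤n/4 n≡ b<a)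

  lower-bound : IsCrg (2 * ⌈ n /4⌉ + 1) T → ∀ {φ} → 2 * φ + h ≤ n / 4 →
                ∀ {z c} → Nearest z c → φ ≤ dist z c
  lower-bound crg {φ} 2φ+h≤q = Crg.crg-lower-bound tree x₀ neighbour crg 3≤n/4 2q≤k
    (ℕ.+-comm (2 * M) 1) (subst (λ h → M < 2 ^ h) h≡ ⌈n/4⌉<2^h) heavy
    {φ} (subst (λ h → 2 * φ + h ≤ n / 4) h≡ 2φ+h≤q)
    where
    open +-*-Solver
    h≡ : h ≡ suc (proj₁ predecessor)
    h≡ = proj₂ predecessor
    M l k : ℕ
    M = ⌈ n /4⌉
    l = 2 * M + 1
    k = n ∸ l + 1
    -- After adding `l`, the claim is `2(M + q) + 1 ≤ n + 1`; evenness of `n` enters here.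
    2q≤k : 2 * (n / 4) ≤ k
    2q≤k = ℕ.+-cancelʳ-≤ l _ _ (begin
      2 * (n / 4) + l        ≡⟨ solve 2 (λ q M → con 2 :* q :+ (con 2 :* M :+ con 1) := con 2 :* (M :+ q) :+ con 1) refl (n / 4) M ⟩
      2 * (M + n / 4) + 1    ≤⟨ ℕ.+-monoˡ-≤ 1 (⌈n/4⌉+n/4≤n/2 {N = proj₁ even} (proj₂ even)) ⟩
      n + 1                  ≡⟨ cong (_+ 1) (ℕ.m∸n+n≡m (ℕ.<⇒≤ (IsCrg.l<n crg))) ⟨
      n ∸ l + l + 1          ≡⟨ solve 2 (λ e l → e :+ l :+ con 1 := e :+ con 1 :+ l) refl (n ∸ l) l ⟩
      k + l                  ∎)
    heavy : n < 2 * l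
    heavy = begin-strict
      n            ≤⟨ n≤4⌈n/4⌉ n ⟩
      4 * M        <⟨ ℕ.≤-trans (ℕ.n≤1+n _) (ℕ.≤-reflexive (solve 1 (λ M → con 2 :+ con 4 :* M := con 2 :* (con 2 :* M :+ con 1)) refl M)) ⟩
      2 * l        ∎

open ℤ using (+_)

corollary3p3 : ∀ {n : ℕ} (T : Graph n) → IsBinaryTree T → 12 ≤ n →
    ∀ (h : ℕ) → IsMin (λ k → 1 ≤ k × ⌈ n /4⌉ ≤ 2 ^ k ∸ 1) h →
    ∃[ d ] IsSetDist T (Center T) (Centroid T) d
    × (+ d ℤ.≤ + (n / 4) ℤ.- + ((n / 4 + 1 + h) / 2))
    × (IsCrg (2 * ⌈ n /4⌉ + 1) T → + d ≡ + (n / 4) ℤ.- + ((n / 4 + 1 + h) / 2))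
corollary3p3 {n} T binary 12≤n h h-min = answer nearest-pair
  where
  open Main T binary 12≤n h-min
  open Extremes T tree x₀ neighbour
  q s : ℕ
  q = n / 4
  s = (q + 1 + h) / 2
  -- The case `d = 0` turns `h ≤ q` into `s ≤ q`, so the integer difference of the theorem agrees
  -- with the truncated one.
  s≤q : s ≤ q
  s≤q = difference-≥ refl {0} (Levels.h≤n/4 12≤n h-min)
  difference : + (q ∸ s) ≡ + q ℤ.- + s
  difference = sym (trans (ℤₚ.m-n≡m⊖n q s) (ℤₚ.⊖-≥ s≤q))
  answer : (∃[ z ] ∃[ c ] Nearest z c) →
    ∃[ d ] IsSetDist T (Center T) (Centroid T) d
      × (+ d ℤ.≤ + q ℤ.- + s) × (IsCrg (2 * ⌈ n /4⌉ + 1) T → + d ≡ + q ℤ.- + s)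
  answer (z , c , near) = dist z c , Nearest.isSetDist near
    , subst (+ dist z c ℤ.≤_) difference (ℤ.+≤+ ≤q∸s)
    , λ crg → trans (cong +_ (ℕ.≤-antisym ≤q∸s (lower-bound crg (difference-bound refl s≤q) near))) difference
    where
    ≤q∸s : dist z c ≤ q ∸ s
    ≤q∸s = ℕ.m+n≤o⇒m≤o∸n (dist z c) (difference-≥ refl (upper-bound near))
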